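{- For integers $m\ge 2$, $n\ge 0$ and $0\le k\le m-1$, $$X_{L^{(k)}_{m,n}}(\mathbf{x};q)=[m-k-1]_q[m-2]_q!\left([m+n]_q\,e_{m+n}+\sum_{i=0}^{n-1}q[m+i-1]_q\,X_{P_{n-i}}(\mathbf{x};q)\,e_{m+i}\right)+q^{m-k-1}[k]_q[m-2]_q!\,X_{P_{n+1}}(\mathbf{x};q)\,e_{m-1}.$$ Consequently $X_{L^{(k)}_{m,n}}(\mathbf{x};q)$ is $e$-positive and $e$-unimodal with center of symmetry $|E(L^{(k)}_{m,n})|/2$.
   Context: $[k]_q=1+q+\dots+q^{k-1}$ ($[0]_q=0$), $[k]_q!=[1]_q\cdots[k]_q$ ($[0]_q!=1$), $e_k$ elementary symmetric function. For a graph $G$ on a vertex set of positive integers, $X_G(\mathbf{x};q)=\sum_\kappa q^{\mathrm{asc}(\kappa)}x^\kappa$ over proper colorings $\kappa:V(G)\to\mathbb{Z}_{>0}$, where $\mathrm{asc}(\kappa)$ counts edges $\{u,v\}$ with $u<v$, $\kappa(u)<\kappa(v)$, and $x^\kappa=\prod_vx_{\kappa(v)}$. $P_{k}$ is the path on $[k]$ with edges $\{j,j+1\}$. The lollipop graph $L_{m,n}$ is the graph on $[m+n]$ with edges $\{j,j+1\}$ for $1\le j\le n$ and all pairs of distinct elements of $\{n+1,\dots,n+m\}$; the melting lollipop graph $L^{(k)}_{m,n}$ is obtained from it by deleting the $k$ edges $\{n+1,n+m\},\{n+1,n+m-1\},\dots,\{n+1,n+m-k+1\}$. Writing $f=\sum_t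 c_t(\mathbf{x})q^t$: $f$ is $e$-positive if every $c_t$ is a nonnegative combination of the $e_\lambda$; $f$ is $e$-unimodal with center of symmetry $c$ if $c_t=c_{2c-t}$ for all $t$ and $c_{t+1}-c_t$ is $e$-positive for $0\le t<c-\tfrac12$. -}

module Defs where

open import Data.Bool.Base using (Bool; true; false; _∧_; _∨_; not; if_then_else_)
open import Data.Nat.Base as ℕ using (ℕ; zero; suc; _≡ᵇ_; _<ᵇ_; _≤ᵇ_; _<_; _≤_)
open import Data.Nat.Properties using () renaming (_≟_ to _≟ℕ_)
open import Data.Integer.Base as ℤ using (ℤ; +_; -_)
open import Data.Fin.Base using (Fin; toℕ)
open import Data.Fin.Properties using () renaming (_≟_ to _≟F_)
open import Data.List.Base as L using (List; []; _∷_; _++_; map; concatMap; foldr; filterᵇ; allFin)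
open import Data.Vec.Base as V using (Vec; []; _∷_; lookup; tabulate; zipWith; replicate)
open import Data.Vec.Properties using (≡-dec)
open import Data.Product.Base using (_×_; _,_; proj₁; proj₂; ∃)
open import Relation.Binary.PropositionalEquality using (_≡_)
open import Relation.Nullary.Decidable using (⌊_⌋)
open import Function.Base using (_∘_)

-- Polynomials in x_1..x_r and q with integer coefficients, as formal sums.
-- A monomial x^α q^t is a pair (α , t) with α ∈ ℕ^r.

Mon : ℕ → Set
Mon r = Vec ℕ r × ℕ

Poly : ℕ → Set
Poly r = List (ℤ × Mon r)

monEq : ∀ {r} → Mon r → Mon r → Bool
monEq (α , s) (β , t) = ⌊ ≡-dec _≟ℕ_ α β ⌋ ∧ (s ≡ᵇ t)

coeff : ∀ {r} → Poly r → Mon r → ℤ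
coeff [] μ = + 0
coeff ((c , ν) ∷ p) μ = (if monEq ν μ then c else + 0) ℤ.+ coeff p μ

_≈ₚ_ : ∀ {r} → Poly r → Poly r → Set
p ≈ₚ p' = ∀ μ → coeff p μ ≡ coeff p' μ

monMul : ∀ {r} → Mon r → Mon r → Mon r
monMul (α , s) (β , t) = zipWith ℕ._+_ α β , s ℕ.+ t

_*ₚ_ : ∀ {r} → Poly r → Poly r → Poly r
p *ₚ p' = concatMap (λ { (c , μ) → map (λ { (d , ν) → (c ℤ.* d , monMul μ ν) }) p' }) p

-- "Symmetric functions" in x = (x_1, x_2, ...) with coefficients in ℤ[q]:
-- a family giving, for every r, the specialisation x_{r+1} = x_{r+2} = ... = 0.
-- Two such power series are equal iff all their coefficients are equal,
-- i.e. iff all specialisations agree.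

SymF : Set
SymF = (r : ℕ) → Poly r

_≈_ : SymF → SymF → Set
f ≈ g = ∀ r → f r ≈ₚ g r

infix 4 _≈_
infixl 6 _⊕_ _⊖_
infixl 7 _⊗_

_⊕_ : SymF → SymF → SymF
(f ⊕ g) r = f r ++ g r

_⊗_ : SymF → SymF → SymF
(f ⊗ g) r = f r *ₚ g r

neg : SymF → SymF
neg f r = map (λ { (c , μ) → (- c , μ) }) (f r)

_⊖_ : SymF → SymF → SymF
f ⊖ g = f ⊕ neg g

zeroS : SymF
zeroS r = []

qpow : ℕ → SymF
qpow t r = (+ 1 , replicate r 0 , t) ∷ []

oneS : SymF
oneS = qpow 0

q : SymF
q = qpow 1

Σ< : ℕ → (ℕ → SymF) → SymF
Σ< zero f = zeroS
Σ< (suc n) f = Σ< n f ⊕ f n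

qint : ℕ → SymF
qint k = Σ< k qpow

qfact : ℕ → SymF
qfact zero = oneS
qfact (suc k) = qfact k ⊗ qint (suc k)

vecsOver : ∀ {A : Set} → List A → (N : ℕ) → List (Vec A N)
vecsOver xs zero = [] ∷ []
vecsOver xs (suc N) = concatMap (λ a → map (a ∷_) (vecsOver xs N)) xs

countB : ∀ {n} → Vec Bool n → ℕ
countB [] = 0
countB (true ∷ v) = suc (countB v)
countB (false ∷ v) = countB v

b2n : Bool → ℕ
b2n true = 1
b2n false = 0

e : ℕ → SymF
e k r = map (λ S → (+ 1 , V.map b2n S , 0))
            (filterᵇ (λ S → countB S ≡ᵇ k) (vecsOver (true ∷ false ∷ []) r))

eλ : List ℕ → SymF
eλ = foldr (λ k f → e k ⊗ f) oneS

coeffQ : ℕ → SymF → SymF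
coeffQ t f r = map (λ { (c , α , s) → (c , α , 0) })
                   (filterᵇ (λ { (c , α , s) → s ≡ᵇ t }) (f r))

-- Graphs on the vertex set [N] = {1,...,N}.  The edge relation is given
-- on labels u < v (each edge {u,v} is queried as edge u v with u < v).

record Graph : Set where
  field
    N    : ℕ
    edge : ℕ → ℕ → Bool
open Graph public

lbl : ∀ {N} → Fin N → ℕ
lbl i = suc (toℕ i)

pairs : ℕ → List (ℕ × ℕ)
pairs N = concatMap (λ v → map (λ u → (suc u , suc v)) (L.upTo v)) (L.upTo N)

edgeCount : Graph → ℕ
edgeCount G = L.length (filterᵇ (λ { (u , v) → edge G u v }) (pairs (N G)))

allB : ∀ {A : Set} → (A → Bool) → List A → Bool
allB p [] = true
allB p (x ∷ xs) = p x ∧ allB p xs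

module _ (G : Graph) {r : ℕ} (κ : Vec (Fin r) (N G)) where
  private
    col : ℕ → ℕ   -- colour (0-based) of the vertex with label u
    col u = colAux κ u
      where
      colAux : ∀ {n} → Vec (Fin r) n → ℕ → ℕ
      colAux [] u = 0
      colAux (c ∷ cs) zero = 0
      colAux (c ∷ cs) (suc zero) = toℕ c
      colAux (c ∷ cs) (suc (suc u)) = colAux cs (suc u)
    edgesL : List (ℕ × ℕ)
    edgesL = filterᵇ (λ { (u , v) → edge G u v }) (pairs (N G))

  proper : Bool
  proper = allB (λ { (u , v) → not (col u ≡ᵇ col v) }) edgesL

  asc : ℕ
  asc = L.length (filterᵇ (λ { (u , v) → col u <ᵇ col v }) edgesL)

  content : Vec ℕ r
  content = tabulate (λ c → L.length (filterᵇ (λ i → ⌊ i ≟F c ⌋) (V.toList κ)))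

-- chromatic quasisymmetric function X_G(x;q) (colours restricted to 1..r
-- in the r-th specialisation)
X : Graph → SymF
X G r = map (λ κ → (+ 1 , content G κ , asc G κ))
            (filterᵇ (proper G) (vecsOver (allFin r) (N G)))

P : ℕ → Graph
P k = record { N = k ; edge = λ u v → v ≡ᵇ suc u }

lollipopEdge : ℕ → ℕ → ℕ → ℕ → Bool
lollipopEdge m n u v =
  ((v ≡ᵇ suc u) ∧ (1 ≤ᵇ u) ∧ (u ≤ᵇ n))
  ∨ ((suc n ≤ᵇ u) ∧ (u <ᵇ v) ∧ (v ≤ᵇ n ℕ.+ m))

deletedEdge : ℕ → ℕ → ℕ → ℕ → ℕ → Bool
deletedEdge m n k u v =
  (u ≡ᵇ suc n) ∧ (suc ((n ℕ.+ m) ℕ.∸ k) ≤ᵇ v) ∧ (v ≤ᵇ n ℕ.+ m)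

Lollipop : ℕ → ℕ → Graph
Lollipop m n = record { N = m ℕ.+ n ; edge = lollipopEdge m n }

MeltingLollipop : ℕ → ℕ → ℕ → Graph
MeltingLollipop m n k =
  record { N = m ℕ.+ n ; edge = λ u v → lollipopEdge m n u v ∧ not (deletedEdge m n k u v) }

-- a nonnegative integer combination of the e_λ (given as a list of
-- partitions, with repetitions encoding multiplicities)
IsEPositiveSym : SymF → Set
IsEPositiveSym g = ∃ λ (Λ : List (List ℕ)) → g ≈ L.foldr (λ λs h → eλ λs ⊕ h) zeroS Λ

EPositive : SymF → Set
EPositive f = ∀ t → IsEPositiveSym (coeffQ t f)

-- e-unimodal with centre of symmetry c = d/2 (d = 2c, so half-integers allowed):
-- c_t = c_{2c - t} for all t (with c_s = 0 for s < 0), and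
-- c_{t+1} - c_t e-positive for 0 ≤ t < c - 1/2, i.e. 2t + 1 < d.
EUnimodalCentreHalf : SymF → ℕ → Set
EUnimodalCentreHalf f d =
  (∀ t → t ≤ d → coeffQ t f ≈ coeffQ (d ℕ.∸ t) f)
  × (∀ t → d < t → coeffQ t f ≈ zeroS)
  × (∀ t → suc (2 ℕ.* t) < d → IsEPositiveSym (coeffQ (suc t) f ⊖ coeffQ t f))

{-# OPTIONS --safe #-}
-- Colour the vertices in increasing order.  Once a vertex has colour c, an edge
-- to a later vertex multiplies the weight x_d of colour d there by 1, 0 or q
-- according as d < c, d = c or d > c; write T_c x for the new weights.  Colouring
-- a vertex with weights x or T_c x and then collecting e_k rests on
--   Σ_d x_d e_k(T_d x) = [k+1] e_{k+1}(x),
--   Σ_d (T_c x)_d e_k(T_d x) = q [k] e_{k+1}(x) + e_{k+1}(T_c x),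
-- both by induction on the number of variables.  They evaluate the clique whose
-- first p = m-k-1 remaining vertices see the colour c of vertex n+1 as
--   [m-2]! ([p] e_{m-1}(T_c x) + q^p [k] e_{m-1}(x)),
-- and the second one moves e_N(T_c x) back along the path, which produces the
-- sum over i.  For e-positivity and e-unimodality, every factor is a sum of terms
-- q^s [l+1] e_λ with a common centre s + l/2; such sums are closed under products
-- because [a+1][b+1] = [a+b+1] + q [a][b].
module Submission where

open import Defs using (Graph; MeltingLollipop; P; edge; pairs; allB; proper; asc)
open import Algebra.Bundles using (CommutativeMonoid; CommutativeSemiring)
import Algebra.Properties.CommutativeMonoid.Sum as MonoidSum
import Algebra.Properties.Semiring.Sum as SemiringSum
import Algebra.Solver.Ring.NaturalCoefficients.Default as Solver
open import Algebra.Structures.Biased using (isCommutativeSemiringˡ)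
open import Data.Bool.Base as Bool using (Bool; true; false; if_then_else_; not; _∧_)
open import Data.Bool.Properties using (T-≡; T-∧; ∧-zeroʳ; ∧-identityʳ)
open import Data.Fin.Base as F using (Fin; toℕ)
open import Data.Fin.Properties using (toℕ<n) renaming (_≟_ to _≟F_)
open import Data.Integer.Base as ℤ using (ℤ; +_)
import Data.Integer.Properties as ℤ
import Data.Integer.Tactic.RingSolver as ℤ-Solver
open import Data.List.Base as L using (List; []; _∷_; _++_; concatMap; map; foldr; applyUpTo; upTo; allFin; filterᵇ; length)
import Data.List.Properties as L
open import Data.List.Relation.Unary.All as All using (All; []; _∷_)
import Data.List.Relation.Unary.All.Properties as All
open import Data.Nat.Base as ℕ using (ℕ; zero; suc; _≡ᵇ_; _<ᵇ_; _<_; _≤_; _∸_; s≤s; z≤n)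
open import Data.Nat.Induction using (<-rec)
import Data.Nat.Properties as ℕ
import Data.Nat.Tactic.RingSolver as ℕ-Solver
open import Data.Product.Base using (_×_; _,_; ∃; Σ-syntax; proj₁; proj₂)
open import Data.Sum.Base using (_⊎_; inj₁; inj₂)
open import Data.Vec.Base as V using (Vec; []; _∷_; lookup; tabulate; zipWith; replicate)
import Data.Vec.Properties as V
open import Function.Base using (_∘_; id)
open import Function.Bundles using (Equivalence)
open import Level using (Level; 0ℓ)
open import Relation.Binary.PropositionalEquality as ≡ using (_≡_; cong; cong₂; subst; subst₂)
import Relation.Binary.Reasoning.Setoid as SetoidReasoning
open import Relation.Binary.Structures using (IsEquivalence)
open import Relation.Nullary using (contradiction)
open import Relation.Nullary.Decidable using (⌊_⌋; isYes≗does; toWitness; fromWitness; yes; no)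

-- Edges and colourings of melting lollipops

-- The induction cannot stay among symmetric functions: the weights `T c x` tell colours below `c`
-- from colours above it, and the next vertex must take them as its given weights. Hence the
-- identities are proved for arbitrary weights in an arbitrary commutative semiring with an element
-- `q`. Only afterwards are they evaluated at the variables, in the semiring of polynomials with
-- polynomials of equal coefficients identified. Vertex n+1 is coloured before the rest of its
-- clique, so the clique becomes a function of that one colour `c`: a constant plus a multiple of
-- `elem (T c x) (m - 1)`. The constant leaves the path free. Since `elem (T c x) 0` is 1, the
-- computation that treats the other term also expands the path itself, and this expansion is the
-- recursion that makes paths sums of centred terms. The common centre is not visible in the
-- formula. It has to be checked that both summands, and all terms of the sum over i, give the same
-- d, and that this d is the number of edges.

shift : (ℕ → ℕ → Bool) → ℕ → ℕ → Bool
shift E u v = E (suc u) (suc v)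

complete : ℕ → ℕ → Bool
complete u v = true

<ᵇ-true : ∀ {m n} → m < n → (m <ᵇ n) ≡ true
<ᵇ-true {m} {n} m<n = Equivalence.to T-≡ (ℕ.<⇒<ᵇ m<n)

not-<ᵇ-suc : ∀ p j → not (p <ᵇ suc j) ≡ (j <ᵇ p)
not-<ᵇ-suc zero j = ≡.refl
not-<ᵇ-suc (suc p) zero = ≡.refl
not-<ᵇ-suc (suc p) (suc j) = not-<ᵇ-suc p j

suc-∸ : ∀ {k N} → k ≤ N → suc N ∸ k ≡ suc (N ∸ k)
suc-∸ = ℕ.+-∸-assoc 1

meltEdge : ℕ → ℕ → ℕ → ℕ → ℕ → Bool
meltEdge m n k = edge (MeltingLollipop m n k)

-- The bound on `k` lets the truncated difference `n + m ∸ k`, the threshold for deleted edges, grow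
-- by one together with the labels.
meltEdge-shift : ∀ {m k} n → k ≤ m → ∀ u v → meltEdge m (suc n) k (2 ℕ.+ u) (2 ℕ.+ v) ≡ meltEdge m n k (1 ℕ.+ u) (1 ℕ.+ v)
meltEdge-shift {m} {k} n k≤m u v rewrite suc-∸ {k} {n ℕ.+ m} (ℕ.≤-trans k≤m (ℕ.m≤n+m m n)) = ≡.refl

meltEdge-stick : ∀ m n k j → meltEdge m (suc n) k 1 (2 ℕ.+ j) ≡ (j ≡ᵇ 0)
meltEdge-stick m n k zero = ≡.refl
meltEdge-stick m n k (suc j) = ≡.refl

meltEdge-first : ∀ {N k} j → k ≤ N → j < N → meltEdge (suc N) 0 k 1 (2 ℕ.+ j) ≡ (j <ᵇ N ∸ k)
meltEdge-first {N} {k} j k≤N j<N rewrite suc-∸ k≤N | <ᵇ-true j<N | ∧-zeroʳ (j ≡ᵇ 0) | ∧-identityʳ (N ∸ k <ᵇ suc j) =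
  not-<ᵇ-suc (N ∸ k) j

meltEdge-rest : ∀ N k u v → u < v → v < N → meltEdge (suc N) 0 k (2 ℕ.+ u) (2 ℕ.+ v) ≡ true
meltEdge-rest N k u v u<v v<N rewrite <ᵇ-true u<v | <ᵇ-true v<N | ∧-zeroʳ (v ≡ᵇ suc u) = ≡.refl

graph : (ℕ → ℕ → Bool) → ℕ → Graph
graph E n = record { N = n ; edge = E }

-- The tests on pairs of vertices performed by proper and asc, recovered by
-- unification since they are local to the definitions of these functions.
tests : ∀ E {r n} (κ : Vec (Fin r) n) →
  Σ[ g ∈ (ℕ × ℕ → Bool) ] Σ[ h ∈ (ℕ × ℕ → Bool) ] Σ[ l ∈ (ℕ × ℕ → Bool) ]
    proper (graph E n) κ ≡ allB h (filterᵇ g (pairs n))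
    × asc (graph E n) κ ≡ length (filterᵇ l (filterᵇ g (pairs n)))
tests E κ = _ , _ , _ , ≡.refl , ≡.refl

edgeTest properTest ascTest : ∀ (E : ℕ → ℕ → Bool) {r n} (κ : Vec (Fin r) n) → ℕ × ℕ → Bool
edgeTest E κ = proj₁ (tests E κ)
properTest E κ = proj₁ (proj₂ (tests E κ))
ascTest E κ = proj₁ (proj₂ (proj₂ (tests E κ)))

-- The test at this pair looks up only the vertices 1 and 2 + j. Dropping the second vertex lowers
-- the other label by one and keeps `c` in front, so the inductive step is definitional.
properTest-first : ∀ E {r n} (c : Fin r) (κ : Vec (Fin r) n) j →
  properTest E (c ∷ κ) (1 , 2 ℕ.+ toℕ j) ≡ not (toℕ c ≡ᵇ toℕ (lookup κ j))
properTest-first E c (d ∷ κ) F.zero = ≡.refl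
properTest-first E c (d ∷ κ) (F.suc j) = properTest-first E c κ j

ascTest-first : ∀ E {r n} (c : Fin r) (κ : Vec (Fin r) n) j →
  ascTest E (c ∷ κ) (1 , 2 ℕ.+ toℕ j) ≡ (toℕ c <ᵇ toℕ (lookup κ j))
ascTest-first E c (d ∷ κ) F.zero = ≡.refl
ascTest-first E c (d ∷ κ) (F.suc j) = ascTest-first E c κ j

-- Sums over lists and over pairs of vertices

module ListSum {a ℓ : Level} (M : CommutativeMonoid a ℓ) where
  open CommutativeMonoid M
  open MonoidSum M using (sum; sum-cong-≋; ∑-distrib-+)
  open SetoidReasoning setoid

  -- An arbitrary commutative monoid is taken because three are used: addition of polynomials,
  -- multiplication of edge weights, and addition of natural numbers for counting edges.
  listSum : ∀ {b} {B : Set b} → (B → Carrier) → List B → Carrier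
  listSum f [] = ε
  listSum f (x ∷ xs) = f x ∙ listSum f xs

  listSum-++ : ∀ {b} {B : Set b} (f : B → Carrier) xs ys → listSum f (xs ++ ys) ≈ listSum f xs ∙ listSum f ys
  listSum-++ f [] ys = sym (identityˡ _)
  listSum-++ f (x ∷ xs) ys = trans (∙-congˡ (listSum-++ f xs ys)) (sym (assoc _ _ _))

  listSum-cong : ∀ {b} {B : Set b} {f g : B → Carrier} → (∀ x → f x ≈ g x) → ∀ xs → listSum f xs ≈ listSum g xs
  listSum-cong f≈g [] = refl
  listSum-cong f≈g (x ∷ xs) = ∙-cong (f≈g x) (listSum-cong f≈g xs)

  listSum-map : ∀ {b c} {B : Set b} {C : Set c} (f : C → Carrier) (g : B → C) xs → listSum f (map g xs) ≈ listSum (f ∘ g) xs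
  listSum-map f g [] = refl
  listSum-map f g (x ∷ xs) = ∙-congˡ (listSum-map f g xs)

  listSum-concatMap : ∀ {b c} {B : Set b} {C : Set c} (f : C → Carrier) (g : B → List C) xs →
    listSum f (concatMap g xs) ≈ listSum (listSum f ∘ g) xs
  listSum-concatMap f g [] = refl
  listSum-concatMap f g (x ∷ xs) = trans (listSum-++ f (g x) _) (∙-congˡ (listSum-concatMap f g xs))

  listSum-tabulate : ∀ {b} {B : Set b} (f : B → Carrier) {n} (g : Fin n → B) → listSum f (L.tabulate g) ≈ sum (f ∘ g)
  listSum-tabulate f {zero} g = refl
  listSum-tabulate f {suc n} g = ∙-congˡ (listSum-tabulate f (g ∘ F.suc))

  listSum-applyUpTo : ∀ (f : ℕ → Carrier) (g : ℕ → ℕ) n → listSum f (applyUpTo g n) ≈ sum {n} (λ i → f (g (toℕ i)))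
  listSum-applyUpTo f g zero = refl
  listSum-applyUpTo f g (suc n) = ∙-congˡ (listSum-applyUpTo f (g ∘ suc) n)

  listSum-pairs : ∀ (f : ℕ × ℕ → Carrier) N →
    listSum f (pairs N) ≈ sum {N} (λ v → sum {toℕ v} (λ u → f (suc (toℕ u) , suc (toℕ v))))
  listSum-pairs f N = trans (listSum-concatMap f _ (upTo N)) (trans
    (listSum-applyUpTo _ _ N)
    (sum-cong-≋ {N} (λ v → trans (listSum-map f _ (upTo (toℕ v))) (listSum-applyUpTo _ _ (toℕ v)))))

  listSum-pairs-cong : ∀ {f f' : ℕ × ℕ → Carrier} N →
    (∀ u v → f (suc u , suc v) ≈ f' (suc u , suc v)) → listSum f (pairs N) ≈ listSum f' (pairs N)
  listSum-pairs-cong {f} {f'} N f≈f' = trans (listSum-pairs f N) (trans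
    (sum-cong-≋ {N} (λ v → sum-cong-≋ {toℕ v} (λ u → f≈f' (toℕ u) (toℕ v)))) (sym (listSum-pairs f' N)))

  -- `pairs` is grouped by the larger endpoint, while recursion on graphs removes the smallest
  -- vertex; commutativity collects the pairs with smaller endpoint 1. The leading `ε` in the proof
  -- is the empty block with larger endpoint 1.
  listSum-pairs-suc : ∀ (f : ℕ × ℕ → Carrier) N →
    listSum f (pairs (suc N)) ≈ sum {N} (λ j → f (1 , 2 ℕ.+ toℕ j)) ∙ listSum (λ (u , v) → f (suc u , suc v)) (pairs N)
  listSum-pairs-suc f N = begin
    listSum f (pairs (suc N))
      ≈⟨ listSum-pairs f (suc N) ⟩
    ε ∙ sum {N} (λ v → f (1 , 2 ℕ.+ toℕ v) ∙ sum {toℕ v} (λ u → f (2 ℕ.+ toℕ u , 2 ℕ.+ toℕ v)))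
      ≈⟨ identityˡ _ ⟩
    sum {N} (λ v → f (1 , 2 ℕ.+ toℕ v) ∙ sum {toℕ v} (λ u → f (2 ℕ.+ toℕ u , 2 ℕ.+ toℕ v)))
      ≈⟨ ∑-distrib-+ {N} (λ v → f (1 , 2 ℕ.+ toℕ v)) _ ⟩
    sum {N} (λ j → f (1 , 2 ℕ.+ toℕ j)) ∙ sum {N} (λ v → sum {toℕ v} (λ u → f (2 ℕ.+ toℕ u , 2 ℕ.+ toℕ v)))
      ≈⟨ ∙-congˡ (listSum-pairs _ N) ⟨
    sum {N} (λ j → f (1 , 2 ℕ.+ toℕ j)) ∙ listSum (λ (u , v) → f (suc u , suc v)) (pairs N) ∎

-- q-integers and elementary symmetric functions of transferred weights

module Transfer {a ℓ : Level} (R : CommutativeSemiring a ℓ) (q : CommutativeSemiring.Carrier R) where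
  open CommutativeSemiring R hiding (zero)
  open SemiringSum semiring public
    using (sum; sum-cong-≋; ∑-distrib-+; *-distribˡ-sum)
  open Solver R using (solve; _:=_; _:+_; _:*_; con)
  open ListSum *-commutativeMonoid using () renaming (listSum to listProd; listSum-pairs-suc to listProd-pairs-suc; listSum-pairs-cong to listProd-pairs-cong)
  open MonoidSum *-commutativeMonoid using () renaming (sum to prod; sum-cong-≋ to prod-cong; ∑-distrib-+ to prod-*)
  open SetoidReasoning setoid

  pow int fact : ℕ → Carrier
  pow zero = 1#
  pow (suc k) = q * pow k
  int zero = 0#
  int (suc k) = int k + pow k
  fact zero = 1#
  fact (suc k) = fact k * int (suc k)

  int-suc : ∀ k → int (suc k) ≈ 1# + q * int k
  int-suc zero = solve 1 (λ q → con 0 :+ con 1 := con 1 :+ q :* con 0) refl q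
  int-suc (suc k) = begin
    int (suc k) + q * pow k       ≈⟨ +-congʳ (int-suc k) ⟩
    (1# + q * int k) + q * pow k  ≈⟨ solve 3 (λ q i w → (con 1 :+ q :* i) :+ q :* w := con 1 :+ q :* (i :+ w)) refl q (int k) (pow k) ⟩
    1# + q * int (suc k)          ∎

  int-+ : ∀ k l → int (k ℕ.+ l) ≈ int k + pow k * int l
  int-+ zero l = solve 1 (λ i → i := con 0 :+ con 1 :* i) refl (int l)
  int-+ (suc k) l = begin
    int (suc (k ℕ.+ l))                  ≈⟨ int-suc (k ℕ.+ l) ⟩
    1# + q * int (k ℕ.+ l)               ≈⟨ +-congˡ (*-congˡ (int-+ k l)) ⟩
    1# + q * (int k + pow k * int l)     ≈⟨ solve 4 (λ q i w j → con 1 :+ q :* (i :+ w :* j) := (con 1 :+ q :* i) :+ (q :* w) :* j) refl q (int k) (pow k) (int l) ⟩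
    (1# + q * int k) + pow (suc k) * int l ≈⟨ +-congʳ (int-suc k) ⟨
    int (suc k) + pow (suc k) * int l    ∎

  -- The factors are unfolded at opposite ends, as [k] + q^k and 1 + q[l]. Apart from q[k][l] this
  -- leaves [k+1] + q^(k+1) [l], a single longer q-integer.
  int-* : ∀ k l → int (suc k) * int (suc l) ≈ int (suc (k ℕ.+ l)) + q * (int k * int l)
  int-* k l = begin
    int (suc k) * int (suc l)                              ≈⟨ *-congˡ (int-suc l) ⟩
    (int k + pow k) * (1# + q * int l)                     ≈⟨ solve 4 (λ q i w j → (i :+ w) :* (con 1 :+ q :* j) := ((i :+ w) :+ (q :* w) :* j) :+ q :* (i :* j)) refl q (int k) (pow k) (int l) ⟩
    (int (suc k) + pow (suc k) * int l) + q * (int k * int l)  ≈⟨ +-congʳ (int-+ (suc k) l) ⟨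
    int (suc (k ℕ.+ l)) + q * (int k * int l)              ∎

  -- Contribution of an edge whose smaller and larger endpoints have colours
  -- c and d.
  t : ∀ {r} → Fin r → Fin r → Carrier
  t c d = if not (toℕ c ≡ᵇ toℕ d) then (if toℕ c <ᵇ toℕ d then q else 1#) else 0#

  T : ∀ {r} → Fin r → (Fin r → Carrier) → Fin r → Carrier
  T c x d = t c d * x d

  -- The variable split off belongs to the smallest colour. Thus `T F.zero` kills it and multiplies
  -- all others by `q`, whereas `T (F.suc c)` leaves it alone, and inductions on the number of
  -- variables pass through `T`.
  elem : ∀ {r} → (Fin r → Carrier) → ℕ → Carrier
  elem x zero = 1#
  elem {zero} x (suc k) = 0#
  elem {suc r} x (suc k) = x F.zero * elem (x ∘ F.suc) k + elem (x ∘ F.suc) (suc k)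

  elem-cong : ∀ {r} {x y : Fin r → Carrier} → (∀ i → x i ≈ y i) → ∀ k → elem x k ≈ elem y k
  elem-cong x≈y zero = refl
  elem-cong {zero} x≈y (suc k) = refl
  elem-cong {suc r} x≈y (suc k) =
    +-cong (*-cong (x≈y F.zero) (elem-cong (x≈y ∘ F.suc) k)) (elem-cong (x≈y ∘ F.suc) (suc k))

  elem-scale : ∀ {r} (x : Fin r → Carrier) k → elem (λ d → q * x d) k ≈ pow k * elem x k
  elem-scale x zero = sym (*-identityˡ 1#)
  elem-scale {zero} x (suc k) = sym (zeroʳ _)
  elem-scale {suc r} x (suc k) = begin
    (q * x₀) * elem (λ d → q * xs d) k + elem (λ d → q * xs d) (suc k)
      ≈⟨ +-cong (*-congˡ (elem-scale xs k)) (elem-scale xs (suc k)) ⟩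
    (q * x₀) * (pow k * elem xs k) + pow (suc k) * elem xs (suc k)
      ≈⟨ solve 5 (λ q x w e e' → (q :* x) :* (w :* e) :+ (q :* w) :* e' := (q :* w) :* (x :* e :+ e')) refl q x₀ (pow k) (elem xs k) (elem xs (suc k)) ⟩
    pow (suc k) * (x₀ * elem xs k + elem xs (suc k)) ∎
    where
    x₀ = x F.zero
    xs = x ∘ F.suc

  elem-T-zero : ∀ {r} (x : Fin (suc r) → Carrier) k → elem (T F.zero x) k ≈ pow k * elem (x ∘ F.suc) k
  elem-T-zero x zero = sym (*-identityˡ 1#)
  elem-T-zero x (suc k) = begin
    (0# * x F.zero) * elem xs' k + elem xs' (suc k)  ≈⟨ solve 3 (λ x e e' → (con 0 :* x) :* e :+ e' := e') refl (x F.zero) (elem xs' k) (elem xs' (suc k)) ⟩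
    elem xs' (suc k)                                 ≈⟨ elem-scale (x ∘ F.suc) (suc k) ⟩
    pow (suc k) * elem (x ∘ F.suc) (suc k)           ∎
    where xs' = λ d → q * x (F.suc d)

  elem-T-suc : ∀ {r} (x : Fin (suc r) → Carrier) c k →
    elem (T (F.suc c) x) (suc k) ≈ x F.zero * elem (T c (x ∘ F.suc)) k + elem (T c (x ∘ F.suc)) (suc k)
  elem-T-suc x c k = +-congʳ (*-congʳ (*-identityˡ _))

  -- `y` is kept arbitrary because it is instantiated with the remaining weights, with `q` times
  -- them, and with `T c` of them.
  sum-elem-T-suc : ∀ {r} (x : Fin (suc r) → Carrier) (y : Fin r → Carrier) k →
    sum (λ d → y d * elem (T (F.suc d) x) (suc k))
      ≈ x F.zero * sum (λ d → y d * elem (T d (x ∘ F.suc)) k) + sum (λ d → y d * elem (T d (x ∘ F.suc)) (suc k))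
  sum-elem-T-suc x y k = begin
    sum (λ d → y d * elem (T (F.suc d) x) (suc k))
      ≈⟨ sum-cong-≋ (λ d → trans (*-congˡ (elem-T-suc x d k))
           (solve 4 (λ y x e e' → y :* (x :* e :+ e') := x :* (y :* e) :+ y :* e') refl (y d) x₀ (elem (T d xs) k) (elem (T d xs) (suc k)))) ⟩
    sum (λ d → x₀ * (y d * elem (T d xs) k) + y d * elem (T d xs) (suc k))
      ≈⟨ ∑-distrib-+ (λ d → x₀ * (y d * elem (T d xs) k)) (λ d → y d * elem (T d xs) (suc k)) ⟩
    sum (λ d → x₀ * (y d * elem (T d xs) k)) + sum (λ d → y d * elem (T d xs) (suc k))
      ≈⟨ +-congʳ (*-distribˡ-sum x₀ (λ d → y d * elem (T d xs) k)) ⟨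
    x₀ * sum (λ d → y d * elem (T d xs) k) + sum (λ d → y d * elem (T d xs) (suc k)) ∎
    where
    x₀ = x F.zero
    xs = x ∘ F.suc

  -- Every subset of size k + 1 arises once for each of its elements d, with
  -- weight q to the number of its elements above d.
  sum-elem-T : ∀ {r} (x : Fin r → Carrier) k → sum (λ d → x d * elem (T d x) k) ≈ int (suc k) * elem x (suc k)
  sum-elem-T {zero} x k = sym (zeroʳ _)
  sum-elem-T {suc r} x zero = begin
    x₀ * 1# + sum (λ d → xs d * 1#)        ≈⟨ +-congˡ (sum-elem-T xs zero) ⟩
    x₀ * 1# + (0# + 1#) * elem xs 1        ≈⟨ solve 2 (λ x e → x :* con 1 :+ (con 0 :+ con 1) :* e := (con 0 :+ con 1) :* (x :* con 1 :+ e)) refl x₀ (elem xs 1) ⟩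
    (0# + 1#) * (x₀ * 1# + elem xs 1)      ∎
    where
    x₀ = x F.zero
    xs = x ∘ F.suc
  sum-elem-T {suc r} x (suc k) = begin
    x₀ * elem (T F.zero x) (suc k) + sum (λ d → xs d * elem (T (F.suc d) x) (suc k))
      ≈⟨ +-cong (*-congˡ (elem-T-zero x (suc k))) (sum-elem-T-suc x xs k) ⟩
    x₀ * (pow (suc k) * e) + (x₀ * sum (λ d → xs d * elem (T d xs) k) + sum (λ d → xs d * elem (T d xs) (suc k)))
      ≈⟨ +-congˡ (+-cong (*-congˡ (sum-elem-T xs k)) (sum-elem-T xs (suc k))) ⟩
    x₀ * (pow (suc k) * e) + (x₀ * (int (suc k) * e) + int (suc (suc k)) * e')
      ≈⟨ solve 5 (λ x w i e e' → x :* (w :* e) :+ (x :* (i :* e) :+ (i :+ w) :* e') := (i :+ w) :* (x :* e :+ e')) refl x₀ (pow (suc k)) (int (suc k)) e e' ⟩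
    int (suc (suc k)) * (x₀ * e + e') ∎
    where
    x₀ = x F.zero
    xs = x ∘ F.suc
    e = elem xs (suc k)
    e' = elem xs (suc (suc k))

  -- Compare the coefficients of a subset of size k + 1 with a elements above `c`. Choosing d above
  -- `c` gives q + ... + q^a. If `c` is not in the subset, the d below `c` give q^a + ... + q^k, so
  -- q^a occurs twice, and the extra q^a is the weight of the subset in `elem (T c x) (suc k)`. If
  -- `c` is in the subset, d = c gives 0, the d below give q^(a+1) + ... + q^k, and nothing is left
  -- over.
  sum-T-elem-T : ∀ {r} (c : Fin r) (x : Fin r → Carrier) k →
    sum (λ d → T c x d * elem (T d x) k) ≈ q * int k * elem x (suc k) + elem (T c x) (suc k)
  sum-T-elem-T {suc r} F.zero x zero = begin
    (0# * x₀) * 1# + sum (λ d → q * xs d * 1#)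
      ≈⟨ +-congˡ (sum-elem-T (λ d → q * xs d) zero) ⟩
    (0# * x₀) * 1# + (0# + 1#) * e
      ≈⟨ solve 4 (λ q x e y → (con 0 :* x) :* con 1 :+ (con 0 :+ con 1) :* e := q :* con 0 :* y :+ ((con 0 :* x) :* con 1 :+ e)) refl q x₀ e (elem x 1) ⟩
    q * 0# * elem x 1 + ((0# * x₀) * 1# + e) ∎
    where
    x₀ = x F.zero
    xs = x ∘ F.suc
    e = elem (λ d → q * xs d) 1
  sum-T-elem-T {suc r} F.zero x (suc k) = begin
    (0# * x₀) * elem (T F.zero x) (suc k) + sum (λ d → q * xs d * elem (T (F.suc d) x) (suc k))
      ≈⟨ +-cong (trans (*-congʳ (zeroˡ x₀)) (zeroˡ _)) (sum-elem-T-suc x (λ d → q * xs d) k) ⟩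
    0# + (x₀ * sum (λ d → q * xs d * elem (T d xs) k) + sum (λ d → q * xs d * elem (T d xs) (suc k)))
      ≈⟨ +-congˡ (+-cong (*-congˡ (pull k)) (pull (suc k))) ⟩
    0# + (x₀ * (q * (int (suc k) * e)) + q * (int (suc (suc k)) * e'))
      ≈⟨ solve 6 (λ q x i w e e' → con 0 :+ (x :* (q :* (i :* e)) :+ q :* ((i :+ w) :* e')) := q :* i :* (x :* e :+ e') :+ (q :* w) :* e') refl q x₀ (int (suc k)) (pow (suc k)) e e' ⟩
    q * int (suc k) * (x₀ * e + e') + pow (suc (suc k)) * e'
      ≈⟨ +-congˡ (elem-T-zero x (suc (suc k))) ⟨
    q * int (suc k) * elem x (suc (suc k)) + elem (T F.zero x) (suc (suc k)) ∎
    where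
    x₀ = x F.zero
    xs = x ∘ F.suc
    e = elem xs (suc k)
    e' = elem xs (suc (suc k))
    pull : ∀ l → sum (λ d → q * xs d * elem (T d xs) l) ≈ q * (int (suc l) * elem xs (suc l))
    pull l = begin
      sum (λ d → q * xs d * elem (T d xs) l)   ≈⟨ sum-cong-≋ (λ d → *-assoc q (xs d) (elem (T d xs) l)) ⟩
      sum (λ d → q * (xs d * elem (T d xs) l)) ≈⟨ *-distribˡ-sum q (λ d → xs d * elem (T d xs) l) ⟨
      q * sum (λ d → xs d * elem (T d xs) l)   ≈⟨ *-congˡ (sum-elem-T xs l) ⟩
      q * (int (suc l) * elem xs (suc l))      ∎
  sum-T-elem-T {suc r} (F.suc c) x zero = begin
    1# * x₀ * 1# + sum (λ d → T c xs d * 1#)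
      ≈⟨ +-congˡ (sum-T-elem-T c xs zero) ⟩
    1# * x₀ * 1# + (q * 0# * elem xs 1 + elem (T c xs) 1)
      ≈⟨ solve 5 (λ q x e f y → con 1 :* x :* con 1 :+ (q :* con 0 :* e :+ f) := q :* con 0 :* y :+ (con 1 :* x :* con 1 :+ f)) refl q x₀ (elem xs 1) (elem (T c xs) 1) (elem x 1) ⟩
    q * 0# * elem x 1 + (1# * x₀ * 1# + elem (T c xs) 1) ∎
    where
    x₀ = x F.zero
    xs = x ∘ F.suc
  sum-T-elem-T {suc r} (F.suc c) x (suc k) = begin
    1# * x₀ * elem (T F.zero x) (suc k) + sum (λ d → T c xs d * elem (T (F.suc d) x) (suc k))
      ≈⟨ +-cong (*-congˡ (elem-T-zero x (suc k))) (sum-elem-T-suc x (T c xs) k) ⟩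
    1# * x₀ * (pow (suc k) * e) + (x₀ * sum (λ d → T c xs d * elem (T d xs) k) + sum (λ d → T c xs d * elem (T d xs) (suc k)))
      ≈⟨ +-congˡ (+-cong (*-congˡ (sum-T-elem-T c xs k)) (sum-T-elem-T c xs (suc k))) ⟩
    1# * x₀ * (pow (suc k) * e) + (x₀ * (q * int k * e + f) + (q * int (suc k) * e' + f'))
      ≈⟨ solve 8 (λ q x w i e e' f f' → con 1 :* x :* ((q :* w) :* e) :+ (x :* (q :* i :* e :+ f) :+ (q :* (i :+ w) :* e' :+ f'))
                 := q :* (i :+ w) :* (x :* e :+ e') :+ (con 1 :* x :* f :+ f')) refl q x₀ (pow k) (int k) e e' f f' ⟩
    q * int (suc k) * (x₀ * e + e') + (1# * x₀ * f + f') ∎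
    where
    x₀ = x F.zero
    xs = x ∘ F.suc
    e = elem xs (suc k)
    e' = elem xs (suc (suc k))
    f = elem (T c xs) (suc k)
    f' = elem (T c xs) (suc (suc k))

  -- Colouring cliques and paths vertex by vertex

  edgeWeight : ∀ {r} → Bool → Fin r → Fin r → Carrier
  edgeWeight b c d = if b then t c d else 1#

  -- The weighted sum over all colourings of the graph on {1,…,N} with edge
  -- relation E, where y j is the colour weight of the vertex j + 1.  Once
  -- vertex 1 is coloured, its edges are absorbed in the weights of the others.
  Z : ∀ {r} → (ℕ → ℕ → Bool) → ℕ → (ℕ → Fin r → Carrier) → Carrier
  Z E zero y = 1#
  Z E (suc N) y = sum (λ c → y 0 c * Z (shift E) N (λ j d → edgeWeight (E 1 (2 ℕ.+ j)) c d * y (suc j) d))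

  Z-cong : ∀ {r} (E E' : ℕ → ℕ → Bool) N {y y' : ℕ → Fin r → Carrier} →
    (∀ u v → u < v → v < N → E (suc u) (suc v) ≡ E' (suc u) (suc v)) →
    (∀ j → j < N → ∀ d → y j d ≈ y' j d) → Z E N y ≈ Z E' N y'
  Z-cong E E' zero E≡E' y≈y' = refl
  Z-cong E E' (suc N) E≡E' y≈y' = sum-cong-≋ λ c → *-cong (y≈y' 0 (s≤s z≤n) c)
    (Z-cong (shift E) (shift E') N (λ u v u<v v<N → E≡E' (suc u) (suc v) (s≤s u<v) (s≤s v<N))
      (λ j j<N d → *-cong (reflexive (≡.cong (λ b → edgeWeight b c d) (E≡E' 0 (suc j) (s≤s z≤n) (s≤s j<N)))) (y≈y' (suc j) (s≤s j<N) d)))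

  -- Every later vertex sees the colour `d` of the first, so the weights of the vertices remain
  -- equal to each other and only change from `x` to `T d x`.
  Z-complete : ∀ {r} N (x : Fin r → Carrier) → Z complete N (λ _ → x) ≈ fact N * elem x N
  Z-complete zero x = sym (*-identityˡ 1#)
  Z-complete (suc N) x = begin
    sum (λ d → x d * Z complete N (λ _ → T d x))
      ≈⟨ sum-cong-≋ (λ d → trans (*-congˡ (Z-complete N (T d x)))
           (solve 3 (λ x f e → x :* (f :* e) := f :* (x :* e)) refl (x d) (fact N) (elem (T d x) N))) ⟩
    sum (λ d → fact N * (x d * elem (T d x) N))
      ≈⟨ *-distribˡ-sum (fact N) (λ d → x d * elem (T d x) N) ⟨
    fact N * sum (λ d → x d * elem (T d x) N)
      ≈⟨ *-congˡ (sum-elem-T x N) ⟩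
    fact N * (int (suc N) * elem x (suc N))
      ≈⟨ *-assoc _ _ _ ⟨
    fact (suc N) * elem x (suc N) ∎

  T-comm : ∀ {r} (c d : Fin r) x i → T c (T d x) i ≈ T d (T c x) i
  T-comm c d x i = solve 3 (λ s t x → s :* (t :* x) := t :* (s :* x)) refl (t c i) (t d i) (x i)

  partialWeight : ∀ {r} → ℕ → Fin r → (Fin r → Carrier) → ℕ → Fin r → Carrier
  partialWeight p c x j = if j <ᵇ p then T c x else x

  -- A complete graph together with one more vertex, of colour c, joined to
  -- its first p vertices only.
  Z-partial : ∀ {r} N p j → p ℕ.+ j ≡ suc N → (c : Fin r) (x : Fin r → Carrier) →
    Z complete (suc N) (partialWeight p c x)
      ≈ fact N * (int p * elem (T c x) (suc N) + pow p * int j * elem x (suc N))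
  Z-partial N zero .(suc N) ≡.refl c x = begin
    Z complete (suc N) (λ _ → x)              ≈⟨ Z-complete (suc N) x ⟩
    fact N * int (suc N) * elem x (suc N)     ≈⟨ solve 4 (λ f i e e' → f :* i :* e := f :* (con 0 :* e' :+ con 1 :* i :* e)) refl (fact N) (int (suc N)) (elem x (suc N)) (elem (T c x) (suc N)) ⟩
    fact N * (0# * elem (T c x) (suc N) + 1# * int (suc N) * elem x (suc N)) ∎
  Z-partial zero (suc zero) zero ≡.refl c x = begin
    sum (λ d → T c x d * 1#)      ≈⟨ sum-elem-T (T c x) 0 ⟩
    (0# + 1#) * elem (T c x) 1    ≈⟨ solve 3 (λ q e e' → (con 0 :+ con 1) :* e := con 1 :* ((con 0 :+ con 1) :* e :+ q :* con 1 :* con 0 :* e')) refl q (elem (T c x) 1) (elem x 1) ⟩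
    1# * ((0# + 1#) * elem (T c x) 1 + q * 1# * 0# * elem x 1) ∎
  Z-partial (suc N) (suc p) j eq c x = begin
    sum (λ d → T c x d * Z complete (suc N) (λ i e → t d e * partialWeight (suc p) c x (suc i) e))
      -- The vertex coloured `d` is one of those that see `c`, so one fewer of them remains, and all
      -- remaining weights acquire `T d`; `absorb` moves `T d` inside `T c`.
      ≈⟨ sum-cong-≋ (λ d → *-congˡ {T c x d} (trans (Z-cong complete complete (suc N) (λ _ _ _ _ → ≡.refl) (λ i _ e → absorb d i e)) (Z-partial N p j p+j≡1+N c (T d x)))) ⟩
    sum (λ d → T c x d * (fact N * (int p * elem (T c (T d x)) (suc N) + pow p * int j * elem (T d x) (suc N))))
      ≈⟨ sum-cong-≋ (λ d → trans (*-congˡ {T c x d} (*-congˡ (+-congʳ (*-congˡ (elem-cong (T-comm c d x) (suc N))))))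
           (solve 6 (λ a f i e w e' → a :* (f :* (i :* e :+ w :* e')) := f :* i :* (a :* e) :+ f :* w :* (a :* e')) refl (T c x d) (fact N) (int p) (elem (T d (T c x)) (suc N)) (pow p * int j) (elem (T d x) (suc N)))) ⟩
    sum (λ d → fact N * int p * A d + fact N * (pow p * int j) * B d)
      ≈⟨ ∑-distrib-+ (λ d → fact N * int p * A d) (λ d → fact N * (pow p * int j) * B d) ⟩
    sum (λ d → fact N * int p * A d) + sum (λ d → fact N * (pow p * int j) * B d)
      ≈⟨ +-cong (*-distribˡ-sum (fact N * int p) A) (*-distribˡ-sum (fact N * (pow p * int j)) B) ⟨
    fact N * int p * sum A + fact N * (pow p * int j) * sum B
      ≈⟨ +-cong (*-congˡ (sum-elem-T (T c x) (suc N))) (*-congˡ (sum-T-elem-T c x (suc N))) ⟩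
    fact N * int p * (int (suc (suc N)) * eT) + fact N * (pow p * int j) * (q * int (suc N) * e + eT)
      ≈⟨ +-cong (*-congˡ (*-congʳ (int-suc (suc N)))) (*-congˡ (+-congʳ refl)) ⟩
    fact N * int p * ((1# + q * int (suc N)) * eT) + fact N * (pow p * int j) * (q * int (suc N) * e + eT)
      ≈⟨ solve 8 (λ f i I q w j e eT → f :* i :* ((con 1 :+ q :* I) :* eT) :+ f :* (w :* j) :* (q :* I :* e :+ eT)
             := f :* ((i :+ w :* j) :* eT :+ (q :* i :* I) :* eT :+ I :* ((q :* w) :* j :* e))) refl (fact N) (int p) (int (suc N)) q (pow p) (int j) e eT ⟩
    fact N * ((int p + pow p * int j) * eT + (q * int p * int (suc N)) * eT + int (suc N) * (pow (suc p) * int j * e))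
      -- As p + j = N + 1, the coefficient [p] + q^p [j] is [N+1]. Now every term contains [N+1],
      -- the factor that extends the q-factorial.
      ≈⟨ *-congˡ (+-congʳ (+-congʳ (*-congʳ (trans (sym (int-+ p j)) (reflexive (≡.cong int p+j≡1+N)))))) ⟩
    fact N * (int (suc N) * eT + (q * int p * int (suc N)) * eT + int (suc N) * (pow (suc p) * int j * e))
      ≈⟨ solve 6 (λ f I i q y eT → f :* (I :* eT :+ (q :* i :* I) :* eT :+ I :* y) := f :* I :* ((con 1 :+ q :* i) :* eT :+ y)) refl (fact N) (int (suc N)) (int p) q (pow (suc p) * int j * e) eT ⟩
    fact N * int (suc N) * ((1# + q * int p) * eT + pow (suc p) * int j * e)
      ≈⟨ *-congˡ (+-congʳ (*-congʳ (int-suc p))) ⟨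
    fact (suc N) * (int (suc p) * eT + pow (suc p) * int j * e) ∎
    where
    p+j≡1+N = ℕ.suc-injective eq
    e = elem x (suc (suc N))
    eT = elem (T c x) (suc (suc N))
    A = λ d → T c x d * elem (T d (T c x)) (suc N)
    B = λ d → T c x d * elem (T d x) (suc N)
    absorb : ∀ d i e → t d e * partialWeight (suc p) c x (suc i) e ≈ partialWeight p c (T d x) i e
    absorb d i e with i <ᵇ p
    ... | true = T-comm d c x e
    ... | false = refl

  -- Transfer along a path with n edges whose first vertex has colour weights
  -- w; the colour of the last vertex is passed on to g.
  W : ∀ {r} → (Fin r → Carrier) → ℕ → (w g : Fin r → Carrier) → Carrier
  W x zero w g = sum (λ c → w c * g c)
  W x (suc n) w g = sum (λ c → w c * W x n (T c x) g)

  W-cong : ∀ {r} (x : Fin r → Carrier) n {w g h} → (∀ c → g c ≈ h c) → W x n w g ≈ W x n w h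
  W-cong x zero {w} g≈h = sum-cong-≋ λ c → *-congˡ {w c} (g≈h c)
  W-cong x (suc n) {w} g≈h = sum-cong-≋ λ c → *-congˡ {w c} (W-cong x n g≈h)

  W-linear : ∀ {r} (x : Fin r → Carrier) n {w} a b (g h : Fin r → Carrier) →
    W x n w (λ c → a * g c + b * h c) ≈ a * W x n w g + b * W x n w h
  W-linear {r} x n {w} a b g h = go n w
    where
    combine : ∀ (w g h : Fin r → Carrier) →
      sum (λ c → w c * (a * g c + b * h c)) ≈ a * sum (λ c → w c * g c) + b * sum (λ c → w c * h c)
    combine w g h = begin
      sum (λ c → w c * (a * g c + b * h c))
        ≈⟨ sum-cong-≋ (λ c → solve 5 (λ w a b g h → w :* (a :* g :+ b :* h) := a :* (w :* g) :+ b :* (w :* h)) refl (w c) a b (g c) (h c)) ⟩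
      sum (λ c → a * (w c * g c) + b * (w c * h c))
        ≈⟨ ∑-distrib-+ (λ c → a * (w c * g c)) (λ c → b * (w c * h c)) ⟩
      sum (λ c → a * (w c * g c)) + sum (λ c → b * (w c * h c))
        ≈⟨ +-cong (*-distribˡ-sum a (λ c → w c * g c)) (*-distribˡ-sum b (λ c → w c * h c)) ⟨
      a * sum (λ c → w c * g c) + b * sum (λ c → w c * h c) ∎
    go : ∀ n w → W x n w (λ c → a * g c + b * h c) ≈ a * W x n w g + b * W x n w h
    go zero w = combine w g h
    go (suc n) w = trans (sum-cong-≋ λ c → *-congˡ {w c} (go n (T c x))) (combine w _ _)

  -- `W` unfolds at the first vertex, but `sum-T-elem-T` acts at the end next to the clique.
  W-last : ∀ {r} (x : Fin r → Carrier) n w g → W x (suc n) w g ≈ W x n w (λ c → sum (λ d → T c x d * g d))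
  W-last x zero w g = refl
  W-last x (suc n) w g = sum-cong-≋ λ c → *-congˡ {w c} (W-last x n (T c x) g)

  pathSum : ∀ {r} → (Fin r → Carrier) → ℕ → Carrier
  pathSum x zero = 1#
  pathSum x (suc n) = W x n x (λ _ → 1#)

  Sum : ℕ → (ℕ → Carrier) → Carrier
  Sum zero f = 0#
  Sum (suc n) f = Sum n f + f n

  Sum-cong : ∀ n {f g} → (∀ i → i < n → f i ≈ g i) → Sum n f ≈ Sum n g
  Sum-cong zero f≈g = refl
  Sum-cong (suc n) f≈g = +-cong (Sum-cong n (λ i i<n → f≈g i (ℕ.m<n⇒m<1+n i<n))) (f≈g n ℕ.≤-refl)

  Sum-head : ∀ n f → Sum (suc n) f ≈ f 0 + Sum n (f ∘ suc)
  Sum-head zero f = trans (+-identityˡ _) (sym (+-identityʳ _))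
  Sum-head (suc n) f = trans (+-congʳ (Sum-head n f)) (+-assoc _ _ _)

  -- The summand of the theorem for m = N + 1.
  pathTerm : ∀ {r} → (Fin r → Carrier) → ℕ → ℕ → ℕ → Carrier
  pathTerm x N n i = q * int (N ℕ.+ i) * pathSum x (n ℕ.∸ i) * elem x (suc (N ℕ.+ i))

  -- Absorbing the last vertex by `sum-T-elem-T` leaves either a constant, which frees the rest of
  -- the path, or `elem (T c x) (suc N)`, to which the induction applies. Hence `i` counts the
  -- vertices absorbed before the constant is taken. At `N = 0` the left side is
  -- `pathSum x (suc n)`.
  W-elem : ∀ {r} (x : Fin r → Carrier) n N →
    W x n x (λ c → elem (T c x) N) ≈ int (suc (N ℕ.+ n)) * elem x (suc (N ℕ.+ n)) + Sum n (pathTerm x N n)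
  W-elem x zero N rewrite ℕ.+-identityʳ N = trans (sum-elem-T x N) (sym (+-identityʳ _))
  W-elem x (suc n) N = begin
    W x (suc n) x (λ c → elem (T c x) N)
      ≈⟨ W-last x n x _ ⟩
    W x n x (λ c → sum (λ d → T c x d * elem (T d x) N))
      ≈⟨ W-cong x n (λ c → trans (sum-T-elem-T c x N) (solve 2 (λ a e → a :+ e := a :* con 1 :+ con 1 :* e) refl (q * int N * elem x (suc N)) (elem (T c x) (suc N)))) ⟩
    W x n x (λ c → q * int N * elem x (suc N) * 1# + 1# * elem (T c x) (suc N))
      ≈⟨ W-linear x n (q * int N * elem x (suc N)) 1# (λ _ → 1#) (λ c → elem (T c x) (suc N)) ⟩
    q * int N * elem x (suc N) * pathSum x (suc n) + 1# * W x n x (λ c → elem (T c x) (suc N))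
      ≈⟨ +-congˡ (*-congˡ (W-elem x n (suc N))) ⟩
    q * int N * elem x (suc N) * pathSum x (suc n) + 1# * (int (suc (suc (N ℕ.+ n))) * elem x (suc (suc (N ℕ.+ n))) + Sum n (pathTerm x (suc N) n))
      ≈⟨ solve 5 (λ a e p y s → a :* e :* p :+ con 1 :* (y :+ s) := y :+ (a :* p :* e :+ s)) refl (q * int N) (elem x (suc N)) (pathSum x (suc n)) (int (suc (suc (N ℕ.+ n))) * elem x (suc (suc (N ℕ.+ n)))) (Sum n (pathTerm x (suc N) n)) ⟩
    int (suc (suc (N ℕ.+ n))) * elem x (suc (suc (N ℕ.+ n))) + (q * int N * pathSum x (suc n) * elem x (suc N) + Sum n (pathTerm x (suc N) n))
      ≈⟨ +-cong (reflexive (≡.cong (λ l → int (suc l) * elem x (suc l)) (≡.sym (ℕ.+-suc N n)))) (+-cong (reflexive (≡.cong (λ l → q * int l * pathSum x (suc n) * elem x (suc l)) (≡.sym (ℕ.+-identityʳ N))))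
           (Sum-cong n (λ i _ → reflexive (≡.cong (λ l → q * int l * pathSum x (n ℕ.∸ i) * elem x (suc l)) (≡.sym (ℕ.+-suc N i)))))) ⟩
    int (suc (N ℕ.+ suc n)) * elem x (suc (N ℕ.+ suc n)) + (pathTerm x N (suc n) 0 + Sum n (pathTerm x N (suc n) ∘ suc))
      ≈⟨ +-congˡ (Sum-head n (pathTerm x N (suc n))) ⟨
    int (suc (N ℕ.+ suc n)) * elem x (suc (N ℕ.+ suc n)) + Sum (suc n) (pathTerm x N (suc n)) ∎

  -- The state of a path after its previous vertex is coloured: only the next vertex sees that
  -- colour.
  headed : ∀ {r} → (w x : Fin r → Carrier) → ℕ → Fin r → Carrier
  headed w x zero = w
  headed w x (suc j) = x

  Z-headed : ∀ {r} E N (x : Fin r → Carrier) → Z E N (λ _ → x) ≈ Z E N (headed x x)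
  Z-headed E N x = Z-cong E E N (λ _ _ _ _ → ≡.refl) λ { zero _ d → refl ; (suc j) _ d → refl }

  edgeWeight-stick : ∀ {r} b j (c : Fin r) x d → b ≡ (j ≡ᵇ 0) → edgeWeight b c d * x d ≈ headed (T c x) x j d
  edgeWeight-stick b zero c x d ≡.refl = refl
  edgeWeight-stick b (suc j) c x d ≡.refl = *-identityˡ _

  Z-path : ∀ {r} n (w x : Fin r → Carrier) → Z (edge (P (suc n))) (suc n) (headed w x) ≈ W x n w (λ _ → 1#)
  Z-path zero w x = refl
  Z-path (suc n) w x = sum-cong-≋ λ c → *-congˡ {w c} (trans
    (Z-cong (shift pathEdge) pathEdge (suc n) (λ _ _ _ _ → ≡.refl)
      (λ j _ d → edgeWeight-stick (pathEdge 1 (2 ℕ.+ j)) j c x d ≡.refl))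
    (Z-path n (T c x) x))
    where pathEdge = edge (P 0)

  Z-pathSum : ∀ {r} n (x : Fin r → Carrier) → Z (edge (P n)) n (λ _ → x) ≈ pathSum x n
  Z-pathSum zero x = refl
  Z-pathSum (suc n) x = trans (Z-headed (edge (P 0)) (suc n) x) (Z-path n x x)

  -- The n edges of the path end in vertex n+1, which is itself one of the `suc N` clique vertices.
  -- Of the `N` others, the deleted edges lead to the last `k`, so the first `N ∸ k` see its colour.
  Z-melt : ∀ {r} N k → k ≤ N → ∀ n (w x : Fin r → Carrier) →
    Z (meltEdge (suc N) n k) (n ℕ.+ suc N) (headed w x)
      ≈ W x n w (λ c → Z complete N (partialWeight (N ∸ k) c x))
  Z-melt N k k≤N zero w x = sum-cong-≋ λ c → *-congˡ {w c}
    (Z-cong (shift (meltEdge (suc N) 0 k)) complete N (λ u v u<v v<N → meltEdge-rest N k u v u<v v<N) (λ j j<N d → first c d j j<N))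
    where
    first : ∀ c d j → j < N → edgeWeight (meltEdge (suc N) 0 k 1 (2 ℕ.+ j)) c d * x d ≈ partialWeight (N ∸ k) c x j d
    first c d j j<N rewrite meltEdge-first j k≤N j<N with j <ᵇ N ∸ k
    ... | true = refl
    ... | false = *-identityˡ _
  Z-melt N k k≤N (suc n) w x = sum-cong-≋ λ c → *-congˡ {w c} (trans
    (Z-cong (shift (meltEdge (suc N) (suc n) k)) (meltEdge (suc N) n k) (n ℕ.+ suc N)
      (λ u v _ _ → meltEdge-shift n (ℕ.m≤n⇒m≤1+n k≤N) u v)
      (λ j _ d → edgeWeight-stick _ j c x d (meltEdge-stick (suc N) n k j)))
    (Z-melt N k k≤N n (T c x) x))

  Z-melt-formula : ∀ {r} N k → k ≤ suc N → ∀ n (x : Fin r → Carrier) →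
    Z (meltEdge (2 ℕ.+ N) n k) (2 ℕ.+ N ℕ.+ n) (λ _ → x)
      ≈ int (suc N ∸ k) * fact N
          * (int (2 ℕ.+ N ℕ.+ n) * elem x (2 ℕ.+ N ℕ.+ n)
             + Sum n (λ i → q * int (suc N ℕ.+ i) * pathSum x (n ∸ i) * elem x (2 ℕ.+ N ℕ.+ i)))
        + pow (suc N ∸ k) * int k * fact N * pathSum x (suc n) * elem x (suc N)
  Z-melt-formula N k k≤1+N n x = begin
    Z (meltEdge (2 ℕ.+ N) n k) (2 ℕ.+ N ℕ.+ n) (λ _ → x)
      -- The graph is defined with m + n vertices, whereas the recursion along the path needs n + m.
      ≡⟨ ≡.cong (λ M → Z (meltEdge (2 ℕ.+ N) n k) M (λ _ → x)) (ℕ.+-comm (2 ℕ.+ N) n) ⟩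
    Z (meltEdge (2 ℕ.+ N) n k) (n ℕ.+ (2 ℕ.+ N)) (λ _ → x)
      ≈⟨ Z-headed (meltEdge (2 ℕ.+ N) n k) (n ℕ.+ (2 ℕ.+ N)) x ⟩
    Z (meltEdge (2 ℕ.+ N) n k) (n ℕ.+ (2 ℕ.+ N)) (headed x x)
      ≈⟨ Z-melt (suc N) k k≤1+N n x x ⟩
    W x n x (λ c → Z complete (suc N) (partialWeight p c x))
      ≈⟨ W-cong x n (λ c → trans (Z-partial N p k (ℕ.m∸n+n≡m k≤1+N) c x)
           (solve 6 (λ f i e w j e' → f :* (i :* e :+ w :* j :* e') := f :* i :* e :+ f :* (w :* j :* e') :* con 1) refl
              (fact N) (int p) (elem (T c x) (suc N)) (pow p) (int k) (elem x (suc N)))) ⟩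
    W x n x (λ c → fact N * int p * elem (T c x) (suc N) + fact N * (pow p * int k * elem x (suc N)) * 1#)
      ≈⟨ W-linear x n (fact N * int p) (fact N * (pow p * int k * elem x (suc N))) (λ c → elem (T c x) (suc N)) (λ _ → 1#) ⟩
    fact N * int p * W x n x (λ c → elem (T c x) (suc N)) + fact N * (pow p * int k * elem x (suc N)) * pathSum x (suc n)
      ≈⟨ +-congʳ (*-congˡ (W-elem x n (suc N))) ⟩
    fact N * int p * Y + fact N * (pow p * int k * elem x (suc N)) * pathSum x (suc n)
      ≈⟨ solve 7 (λ f i y w j e s → f :* i :* y :+ f :* (w :* j :* e) :* s := i :* f :* y :+ w :* j :* f :* s :* e) refl
           (fact N) (int p) Y (pow p) (int k) (elem x (suc N)) (pathSum x (suc n)) ⟩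
    int p * fact N * Y + pow p * int k * fact N * pathSum x (suc n) * elem x (suc N) ∎
    where
    p = suc N ∸ k
    Y = int (2 ℕ.+ N ℕ.+ n) * elem x (2 ℕ.+ N ℕ.+ n) + Sum n (pathTerm x (suc N) n)

  -- Expansion of the transfer sums over colourings

  edgeProduct : ∀ {r N} → (ℕ → ℕ → Bool) → Vec (Fin r) N → Carrier
  edgeProduct E [] = 1#
  edgeProduct E (c ∷ κ) = prod (λ j → edgeWeight (E 1 (2 ℕ.+ toℕ j)) c (lookup κ j)) * edgeProduct (shift E) κ

  sumVec : ∀ {r} N → (Vec (Fin r) N → Carrier) → Carrier
  sumVec zero f = f []
  sumVec (suc N) f = sum (λ c → sumVec N (λ κ → f (c ∷ κ)))

  sumVec-cong : ∀ {r} N {f g : Vec (Fin r) N → Carrier} → (∀ κ → f κ ≈ g κ) → sumVec N f ≈ sumVec N g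
  sumVec-cong zero f≈g = f≈g []
  sumVec-cong (suc N) f≈g = sum-cong-≋ λ c → sumVec-cong N (λ κ → f≈g (c ∷ κ))

  *-distribˡ-sumVec : ∀ {r} N a (f : Vec (Fin r) N → Carrier) → a * sumVec N f ≈ sumVec N (λ κ → a * f κ)
  *-distribˡ-sumVec zero a f = refl
  *-distribˡ-sumVec (suc N) a f = trans (*-distribˡ-sum a (λ c → sumVec N (λ κ → f (c ∷ κ))))
    (sum-cong-≋ λ c → *-distribˡ-sumVec N a (λ κ → f (c ∷ κ)))

  -- Distributivity separates the colour weights from the edges that `Z` merged into them. `y` has
  -- to be arbitrary because the inductive call is made with weights that already contain the edges
  -- of vertex 1.
  Z-expand : ∀ {r} E N (y : ℕ → Fin r → Carrier) →
    Z E N y ≈ sumVec N (λ κ → prod (λ j → y (toℕ j) (lookup κ j)) * edgeProduct E κ)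
  Z-expand E zero y = sym (*-identityˡ 1#)
  Z-expand E (suc N) y = sum-cong-≋ λ c → begin
    y 0 c * Z (shift E) N (λ j d → edgeWeight (E 1 (2 ℕ.+ j)) c d * y (suc j) d)
      ≈⟨ *-congˡ (Z-expand (shift E) N _) ⟩
    y 0 c * sumVec N (λ κ → prod (λ j → edgeWeight (E 1 (2 ℕ.+ toℕ j)) c (lookup κ j) * y (suc (toℕ j)) (lookup κ j)) * edgeProduct (shift E) κ)
      ≈⟨ *-distribˡ-sumVec N (y 0 c) _ ⟩
    sumVec N (λ κ → y 0 c * (prod (λ j → edgeWeight (E 1 (2 ℕ.+ toℕ j)) c (lookup κ j) * y (suc (toℕ j)) (lookup κ j)) * edgeProduct (shift E) κ))
      ≈⟨ sumVec-cong N (λ κ → trans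
           (*-congˡ (*-congʳ (prod-* (λ j → edgeWeight (E 1 (2 ℕ.+ toℕ j)) c (lookup κ j)) (λ j → y (suc (toℕ j)) (lookup κ j)))))
           (solve 4 (λ a b c d → a :* ((b :* c) :* d) := (a :* c) :* (b :* d)) refl (y 0 c) _ _ (edgeProduct (shift E) κ))) ⟩
    sumVec N (λ κ → (y 0 c * prod (λ j → y (suc (toℕ j)) (lookup κ j)))
                    * (prod (λ j → edgeWeight (E 1 (2 ℕ.+ toℕ j)) c (lookup κ j)) * edgeProduct (shift E) κ)) ∎

  filterFactor : ∀ {b} {B : Set b} (g h l : B → Bool) → B → Carrier
  filterFactor g h l x = if g x then (if h x then (if l x then q else 1#) else 0#) else 1#

  -- Properness and the number of ascents are global data of a colouring. Written with one factor
  -- per pair, 0 for an edge of one colour and `q` for an ascent, they can be split along the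
  -- smallest vertex.
  filterProduct : ∀ {B : Set} (g h l : B → Bool) xs →
    (if allB h (filterᵇ g xs) then pow (length (filterᵇ l (filterᵇ g xs))) else 0#) ≈ listProd (filterFactor g h l) xs
  filterProduct g h l [] = refl
  filterProduct g h l (x ∷ xs) with g x
  ... | false = trans (filterProduct g h l xs) (sym (*-identityˡ _))
  ... | true with h x
  ...   | false = sym (zeroˡ _)
  ...   | true with l x | filterProduct g h l xs
  ...     | false | ih = trans ih (sym (*-identityˡ _))
  ...     | true | ih with allB h (filterᵇ g xs)
  ...       | true = *-congˡ ih
  ...       | false = trans (sym (zeroʳ q)) (*-congˡ ih)

  -- Passing to the tail of a colouring commutes with the tests definitionally:
  -- they look colours up with a function that ignores its other parameters.
  edgeProduct-pairs : ∀ E {r n} (κ : Vec (Fin r) n) →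
    listProd (filterFactor (edgeTest E κ) (properTest E κ) (ascTest E κ)) (pairs n) ≈ edgeProduct E κ
  edgeProduct-pairs E [] = refl
  edgeProduct-pairs E {n = suc n} (c ∷ κ) = trans
    (listProd-pairs-suc (filterFactor (edgeTest E (c ∷ κ)) (properTest E (c ∷ κ)) (ascTest E (c ∷ κ))) n)
    (*-cong (prod-cong first) (trans (listProd-pairs-cong n (λ u v → refl)) (edgeProduct-pairs (shift E) κ)))
    where
    first : ∀ j → filterFactor (edgeTest E (c ∷ κ)) (properTest E (c ∷ κ)) (ascTest E (c ∷ κ)) (1 , 2 ℕ.+ toℕ j)
      ≈ edgeWeight (E 1 (2 ℕ.+ toℕ j)) c (lookup κ j)
    first j rewrite properTest-first E c κ j | ascTest-first E c κ j = refl

  colouringWeight : ∀ E {r n} (κ : Vec (Fin r) n) →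
    (if proper (graph E n) κ then pow (asc (graph E n) κ) else 0#) ≈ edgeProduct E κ
  colouringWeight E {n = n} κ = trans (filterProduct (edgeTest E κ) (properTest E κ) (ascTest E κ) (pairs n)) (edgeProduct-pairs E κ)

-- Polynomials as a semiring

open Defs hiding (_≈_)

monEq⇒≡ : ∀ {r} (μ ν : Mon r) → Bool.T (monEq μ ν) → μ ≡ ν
monEq⇒≡ (α , s) (β , t) eq with Equivalence.to T-∧ eq
... | α≡β , s≡t = cong₂ _,_ (toWitness α≡β) (ℕ.≡ᵇ⇒≡ s t s≡t)

≡⇒monEq : ∀ {r} (μ ν : Mon r) → μ ≡ ν → Bool.T (monEq μ ν)
≡⇒monEq (α , s) .(α , s) ≡.refl = Equivalence.from T-∧ (fromWitness ≡.refl , ℕ.≡⇒≡ᵇ s s ≡.refl)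

T-ext : ∀ {a b} → (Bool.T a → Bool.T b) → (Bool.T b → Bool.T a) → a ≡ b
T-ext {false} {false} f g = ≡.refl
T-ext {false} {true} f g with () ← g _
T-ext {true} {false} f g with () ← f _
T-ext {true} {true} f g = ≡.refl

monMul-assoc : ∀ {r} (μ ν ρ : Mon r) → monMul (monMul μ ν) ρ ≡ monMul μ (monMul ν ρ)
monMul-assoc (α , s) (β , t) (γ , u) = cong₂ _,_ (V.zipWith-assoc ℕ.+-assoc α β γ) (ℕ.+-assoc s t u)

monMul-comm : ∀ {r} (μ ν : Mon r) → monMul μ ν ≡ monMul ν μ
monMul-comm (α , s) (β , t) = cong₂ _,_ (V.zipWith-comm ℕ.+-comm α β) (ℕ.+-comm s t)

monMul-identityˡ : ∀ {r} (μ : Mon r) → monMul (replicate r 0 , 0) μ ≡ μ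
monMul-identityˡ (α , s) = cong (_, s) (V.zipWith-identityˡ ℕ.+-identityˡ α)

-- The subtraction is truncated, so this is a quotient only if multiplying back recovers the
-- dividend; `⟦⟧-monMul-cong` makes that test.
monDiv : ∀ {r} → Mon r → Mon r → Mon r
monDiv (α , s) (β , t) = zipWith ℕ._∸_ α β , s ℕ.∸ t

monDiv-monMul : ∀ {r} (μ ν : Mon r) → monDiv (monMul μ ν) μ ≡ ν
monDiv-monMul (α , s) (β , t) = cong₂ _,_ (vec α β) (ℕ.m+n∸m≡n s t)
  where
  vec : ∀ {r} (α β : Vec ℕ r) → zipWith ℕ._∸_ (zipWith ℕ._+_ α β) α ≡ β
  vec [] [] = ≡.refl
  vec (a ∷ α) (b ∷ β) = cong₂ _∷_ (ℕ.m+n∸m≡n a b) (vec α β)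

-- The pairing of a polynomial with a linear functional on monomials; the
-- coefficients are its values at the functionals δ.
⟦_⟧ : ∀ {r} → Poly r → (Mon r → ℤ) → ℤ
⟦ [] ⟧ φ = + 0
⟦ (c , ν) ∷ p ⟧ φ = c ℤ.* φ ν ℤ.+ ⟦ p ⟧ φ

δ : ∀ {r} → Mon r → Mon r → ℤ
δ μ ν = if monEq ν μ then + 1 else + 0

coeff-⟦⟧ : ∀ {r} (p : Poly r) μ → coeff p μ ≡ ⟦ p ⟧ (δ μ)
coeff-⟦⟧ [] μ = ≡.refl
coeff-⟦⟧ ((c , ν) ∷ p) μ = cong₂ ℤ._+_ (if-* (monEq ν μ)) (coeff-⟦⟧ p μ)
  where
  if-* : ∀ b → (if b then c else + 0) ≡ c ℤ.* (if b then + 1 else + 0)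
  if-* true = ≡.sym (ℤ.*-identityʳ c)
  if-* false = ≡.sym (ℤ.*-zeroʳ c)

⟦⟧-cong : ∀ {r} (p : Poly r) {φ ψ} → (∀ ν → φ ν ≡ ψ ν) → ⟦ p ⟧ φ ≡ ⟦ p ⟧ ψ
⟦⟧-cong [] φ≡ψ = ≡.refl
⟦⟧-cong ((c , ν) ∷ p) φ≡ψ = cong₂ ℤ._+_ (cong (c ℤ.*_) (φ≡ψ ν)) (⟦⟧-cong p φ≡ψ)

⟦⟧-++ : ∀ {r} (p p' : Poly r) φ → ⟦ p ++ p' ⟧ φ ≡ ⟦ p ⟧ φ ℤ.+ ⟦ p' ⟧ φ
⟦⟧-++ [] p' φ = ≡.sym (ℤ.+-identityˡ _)
⟦⟧-++ ((c , ν) ∷ p) p' φ = ≡.trans (cong (ℤ._+_ (c ℤ.* φ ν)) (⟦⟧-++ p p' φ)) (≡.sym (ℤ.+-assoc (c ℤ.* φ ν) _ _))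

⟦⟧-0 : ∀ {r} (p : Poly r) → ⟦ p ⟧ (λ _ → + 0) ≡ + 0
⟦⟧-0 [] = ≡.refl
⟦⟧-0 ((c , ν) ∷ p) = cong₂ ℤ._+_ (ℤ.*-zeroʳ c) (⟦⟧-0 p)

⟦⟧-linear : ∀ {r} (p : Poly r) a φ ψ → ⟦ p ⟧ (λ ν → a ℤ.* φ ν ℤ.+ ψ ν) ≡ a ℤ.* ⟦ p ⟧ φ ℤ.+ ⟦ p ⟧ ψ
⟦⟧-linear [] a φ ψ = lem a
  where
  lem : ∀ a → + 0 ≡ a ℤ.* + 0 ℤ.+ + 0
  lem = ℤ-Solver.solve-∀
⟦⟧-linear ((c , ν) ∷ p) a φ ψ = ≡.trans (cong (ℤ._+_ (c ℤ.* (a ℤ.* φ ν ℤ.+ ψ ν))) (⟦⟧-linear p a φ ψ)) (lem c a (φ ν) (ψ ν) (⟦ p ⟧ φ) (⟦ p ⟧ ψ))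
  where
  lem : ∀ c a x y u v → c ℤ.* (a ℤ.* x ℤ.+ y) ℤ.+ (a ℤ.* u ℤ.+ v) ≡ a ℤ.* (c ℤ.* x ℤ.+ u) ℤ.+ (c ℤ.* y ℤ.+ v)
  lem = ℤ-Solver.solve-∀

-- Products become iterated pairings, so commutativity and associativity follow from exchanging
-- pairings and from the laws of `monMul`, whatever the order of the terms in the lists.
⟦⟧-*ₚ : ∀ {r} (p p' : Poly r) φ → ⟦ p *ₚ p' ⟧ φ ≡ ⟦ p ⟧ (λ ν → ⟦ p' ⟧ (λ ρ → φ (monMul ν ρ)))
⟦⟧-*ₚ [] p' φ = ≡.refl
⟦⟧-*ₚ ((c , ν) ∷ p) p' φ = ≡.trans (⟦⟧-++ (L.map _ p') (p *ₚ p') φ) (cong₂ ℤ._+_ (scale p') (⟦⟧-*ₚ p p' φ))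
  where
  lem : ∀ c d x u → c ℤ.* d ℤ.* x ℤ.+ c ℤ.* u ≡ c ℤ.* (d ℤ.* x ℤ.+ u)
  lem = ℤ-Solver.solve-∀
  scale : ∀ p' → ⟦ L.map (λ { (d , ρ) → c ℤ.* d , monMul ν ρ }) p' ⟧ φ ≡ c ℤ.* ⟦ p' ⟧ (λ ρ → φ (monMul ν ρ))
  scale [] = ≡.sym (ℤ.*-zeroʳ c)
  scale ((d , ρ) ∷ p') = ≡.trans (cong (ℤ._+_ (c ℤ.* d ℤ.* φ (monMul ν ρ))) (scale p')) (lem c d _ _)

⟦⟧-swap : ∀ {r} (p p' : Poly r) (φ : Mon r → Mon r → ℤ) →
  ⟦ p ⟧ (λ ν → ⟦ p' ⟧ (φ ν)) ≡ ⟦ p' ⟧ (λ ρ → ⟦ p ⟧ (λ ν → φ ν ρ))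
⟦⟧-swap [] p' φ = ≡.sym (⟦⟧-0 p')
⟦⟧-swap ((c , ν) ∷ p) p' φ = ≡.trans (cong (ℤ._+_ (c ℤ.* ⟦ p' ⟧ (φ ν))) (⟦⟧-swap p p' φ)) (≡.sym (⟦⟧-linear p' c (φ ν) _))

infix 4 _≋_
-- A record, since `_≈ₚ_` unfolds to equations between coefficients, from which the two polynomials
-- cannot be inferred.
record _≋_ {r} (p p' : Poly r) : Set where
  constructor ≋-intro
  field coeffs : p ≈ₚ p'
open _≋_ public

⟦⟧⇒≋ : ∀ {r} {p p' : Poly r} → (∀ φ → ⟦ p ⟧ φ ≡ ⟦ p' ⟧ φ) → p ≋ p'
⟦⟧⇒≋ {p = p} {p'} eq = ≋-intro λ μ → ≡.trans (coeff-⟦⟧ p μ) (≡.trans (eq (δ μ)) (≡.sym (coeff-⟦⟧ p' μ)))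

≡⇒≋ : ∀ {r} {p p' : Poly r} → p ≡ p' → p ≋ p'
≡⇒≋ ≡.refl = ≋-intro λ _ → ≡.refl

coeff-++ : ∀ {r} (p p' : Poly r) μ → coeff (p ++ p') μ ≡ coeff p μ ℤ.+ coeff p' μ
coeff-++ [] p' μ = ≡.sym (ℤ.+-identityˡ _)
coeff-++ ((c , ν) ∷ p) p' μ = ≡.trans (cong (ℤ._+_ a) (coeff-++ p p' μ)) (≡.sym (ℤ.+-assoc a (coeff p μ) (coeff p' μ)))
  where a = if monEq ν μ then c else + 0

++-cong : ∀ {r} {p₁ p₂ p₁' p₂' : Poly r} → p₁ ≋ p₂ → p₁' ≋ p₂' → (p₁ ++ p₁') ≋ (p₂ ++ p₂')
++-cong {p₁ = p₁} {p₂} {p₁'} {p₂'} eq eq' = ≋-intro λ μ →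
  ≡.trans (coeff-++ p₁ p₁' μ) (≡.trans (cong₂ ℤ._+_ (coeffs eq μ) (coeffs eq' μ)) (≡.sym (coeff-++ p₂ p₂' μ)))

*ₚ-comm : ∀ {r} (p p' : Poly r) → (p *ₚ p') ≋ (p' *ₚ p)
*ₚ-comm p p' = ⟦⟧⇒≋ λ φ → begin
  ⟦ p *ₚ p' ⟧ φ                                ≡⟨ ⟦⟧-*ₚ p p' φ ⟩
  ⟦ p ⟧ (λ ν → ⟦ p' ⟧ (λ ρ → φ (monMul ν ρ)))  ≡⟨ ⟦⟧-swap p p' _ ⟩
  ⟦ p' ⟧ (λ ρ → ⟦ p ⟧ (λ ν → φ (monMul ν ρ)))  ≡⟨ ⟦⟧-cong p' (λ ρ → ⟦⟧-cong p λ ν → cong φ (monMul-comm ν ρ)) ⟩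
  ⟦ p' ⟧ (λ ρ → ⟦ p ⟧ (λ ν → φ (monMul ρ ν)))  ≡⟨ ⟦⟧-*ₚ p' p φ ⟨
  ⟦ p' *ₚ p ⟧ φ                                ∎
  where open ≡.≡-Reasoning

*ₚ-assoc : ∀ {r} (p p' p'' : Poly r) → ((p *ₚ p') *ₚ p'') ≋ (p *ₚ (p' *ₚ p''))
*ₚ-assoc p p' p'' = ⟦⟧⇒≋ λ φ → begin
  ⟦ (p *ₚ p') *ₚ p'' ⟧ φ                                                   ≡⟨ ⟦⟧-*ₚ (p *ₚ p') p'' φ ⟩
  ⟦ p *ₚ p' ⟧ (λ ν → ⟦ p'' ⟧ (λ ρ → φ (monMul ν ρ)))                       ≡⟨ ⟦⟧-*ₚ p p' _ ⟩
  ⟦ p ⟧ (λ μ → ⟦ p' ⟧ (λ ν → ⟦ p'' ⟧ (λ ρ → φ (monMul (monMul μ ν) ρ))))   ≡⟨ ⟦⟧-cong p (λ μ → ⟦⟧-cong p' λ ν → ⟦⟧-cong p'' λ ρ → cong φ (monMul-assoc μ ν ρ)) ⟩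
  ⟦ p ⟧ (λ μ → ⟦ p' ⟧ (λ ν → ⟦ p'' ⟧ (λ ρ → φ (monMul μ (monMul ν ρ)))))   ≡⟨ ⟦⟧-cong p (λ μ → ⟦⟧-*ₚ p' p'' (φ ∘ monMul μ)) ⟨
  ⟦ p ⟧ (λ μ → ⟦ p' *ₚ p'' ⟧ (λ ρ → φ (monMul μ ρ)))                       ≡⟨ ⟦⟧-*ₚ p (p' *ₚ p'') φ ⟨
  ⟦ p *ₚ (p' *ₚ p'') ⟧ φ                                                   ∎
  where open ≡.≡-Reasoning

*ₚ-identityˡ : ∀ {r} (p : Poly r) → (oneS r *ₚ p) ≋ p
*ₚ-identityˡ p = ⟦⟧⇒≋ λ φ → begin
  ⟦ oneS _ *ₚ p ⟧ φ                                           ≡⟨ ⟦⟧-*ₚ (oneS _) p φ ⟩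
  + 1 ℤ.* ⟦ p ⟧ (λ ρ → φ (monMul (replicate _ 0 , 0) ρ)) ℤ.+ + 0  ≡⟨ lem _ ⟩
  ⟦ p ⟧ (λ ρ → φ (monMul (replicate _ 0 , 0) ρ))              ≡⟨ ⟦⟧-cong p (λ ρ → cong φ (monMul-identityˡ ρ)) ⟩
  ⟦ p ⟧ φ                                                     ∎
  where
  open ≡.≡-Reasoning
  lem : ∀ x → + 1 ℤ.* x ℤ.+ + 0 ≡ x
  lem = ℤ-Solver.solve-∀

*ₚ-distribʳ-++ : ∀ {r} (p'' p p' : Poly r) → ((p ++ p') *ₚ p'') ≋ ((p *ₚ p'') ++ (p' *ₚ p''))
*ₚ-distribʳ-++ p'' p p' = ≡⇒≋ (L.concatMap-++ _ p p')

-- Multiplication by a monomial ν moves the coefficient at μ / ν to μ, and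
-- produces no monomial that ν does not divide.
⟦⟧-monMul-cong : ∀ {r} {p p' : Poly r} → p ≋ p' → ∀ ν μ →
  ⟦ p ⟧ (λ ρ → δ μ (monMul ν ρ)) ≡ ⟦ p' ⟧ (λ ρ → δ μ (monMul ν ρ))
⟦⟧-monMul-cong {p = p} {p'} p≋p' ν μ with monEq (monMul ν (monDiv μ ν)) μ in eq
... | true = begin
  ⟦ p ⟧ (λ ρ → δ μ (monMul ν ρ))   ≡⟨ ⟦⟧-cong p δ-shift ⟩
  ⟦ p ⟧ (δ μ/ν)                    ≡⟨ coeff-⟦⟧ p μ/ν ⟨
  coeff p μ/ν                      ≡⟨ coeffs p≋p' μ/ν ⟩
  coeff p' μ/ν                     ≡⟨ coeff-⟦⟧ p' μ/ν ⟩
  ⟦ p' ⟧ (δ μ/ν)                   ≡⟨ ⟦⟧-cong p' δ-shift ⟨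
  ⟦ p' ⟧ (λ ρ → δ μ (monMul ν ρ))  ∎
  where
  open ≡.≡-Reasoning
  μ/ν = monDiv μ ν
  μ≡ : monMul ν μ/ν ≡ μ
  μ≡ = monEq⇒≡ _ _ (Equivalence.from T-≡ eq)
  δ-shift : ∀ ρ → δ μ (monMul ν ρ) ≡ δ μ/ν ρ
  δ-shift ρ = cong (λ b → if b then + 1 else + 0) (T-ext
    (λ h → ≡⇒monEq _ _ (≡.trans (≡.sym (monDiv-monMul ν ρ)) (cong (λ μ → monDiv μ ν) (monEq⇒≡ (monMul ν ρ) μ h))))
    (λ h → ≡⇒monEq _ _ (≡.trans (cong (monMul ν) (monEq⇒≡ ρ μ/ν h)) μ≡)))
... | false = ≡.trans (≡.trans (⟦⟧-cong p δ-zero) (⟦⟧-0 p)) (≡.sym (≡.trans (⟦⟧-cong p' δ-zero) (⟦⟧-0 p')))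
  where
  δ-zero : ∀ ρ → δ μ (monMul ν ρ) ≡ + 0
  δ-zero ρ with monEq (monMul ν ρ) μ in eq'
  ... | false = ≡.refl
  -- If ν times ρ were μ, dividing by ν would return ρ and μ would pass the divisibility test,
  -- contrary to `eq`.
  ... | true with ≡.refl ← monEq⇒≡ (monMul ν ρ) μ (Equivalence.from T-≡ eq')
    with () ← ≡.trans (≡.sym eq) (Equivalence.to T-≡ (≡⇒monEq _ _ (cong (monMul ν) (monDiv-monMul ν ρ))))

-- The ring laws were proved for all functionals, but equal coefficients give equality only at the
-- `δ μ`. It therefore matters that a product meets its second factor only through translates of
-- `δ μ` by a monomial.
*ₚ-congˡ : ∀ {r} (p'' : Poly r) {p p'} → p ≋ p' → (p'' *ₚ p) ≋ (p'' *ₚ p')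
*ₚ-congˡ p'' {p} {p'} p≋p' = ≋-intro λ μ → begin
  coeff (p'' *ₚ p) μ                                 ≡⟨ expand p μ ⟩
  ⟦ p'' ⟧ (λ ν → ⟦ p ⟧ (λ ρ → δ μ (monMul ν ρ)))     ≡⟨ ⟦⟧-cong p'' (λ ν → ⟦⟧-monMul-cong p≋p' ν μ) ⟩
  ⟦ p'' ⟧ (λ ν → ⟦ p' ⟧ (λ ρ → δ μ (monMul ν ρ)))    ≡⟨ expand p' μ ⟨
  coeff (p'' *ₚ p') μ                                ∎
  where
  open ≡.≡-Reasoning
  expand : ∀ p μ → coeff (p'' *ₚ p) μ ≡ ⟦ p'' ⟧ (λ ν → ⟦ p ⟧ (λ ρ → δ μ (monMul ν ρ)))
  expand p μ = ≡.trans (coeff-⟦⟧ (p'' *ₚ p) μ) (⟦⟧-*ₚ p'' p (δ μ))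

module _ (r : ℕ) where
  ≋-isEquivalence : IsEquivalence (_≋_ {r})
  ≋-isEquivalence = record
    { refl = ≋-intro λ _ → ≡.refl
    ; sym = λ eq → ≋-intro λ μ → ≡.sym (coeffs eq μ)
    ; trans = λ eq eq' → ≋-intro λ μ → ≡.trans (coeffs eq μ) (coeffs eq' μ)
    }

  private
    ≋-trans : ∀ {p p' p'' : Poly r} → p ≋ p' → p' ≋ p'' → p ≋ p''
    ≋-trans = IsEquivalence.trans ≋-isEquivalence

  polySemiring : CommutativeSemiring 0ℓ 0ℓ
  polySemiring = record
    { Carrier = Poly r
    ; _≈_ = _≋_
    ; _+_ = _++_
    ; _*_ = _*ₚ_
    ; 0# = []
    ; 1# = oneS r
    ; isCommutativeSemiring = isCommutativeSemiringˡ record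
      { +-isCommutativeMonoid = record
        { isMonoid = record
          { isSemigroup = record
            { isMagma = record { isEquivalence = ≋-isEquivalence ; ∙-cong = ++-cong }
            ; assoc = λ p p' p'' → ≡⇒≋ (L.++-assoc p p' p'')
            }
          ; identity = (λ p → ≡⇒≋ ≡.refl) , (λ p → ≡⇒≋ (L.++-identityʳ p))
          }
        ; comm = λ p p' → ≋-intro λ μ →
            ≡.trans (coeff-++ p p' μ) (≡.trans (ℤ.+-comm (coeff p μ) (coeff p' μ)) (≡.sym (coeff-++ p' p μ)))
        }
      ; *-isCommutativeMonoid = record
        { isMonoid = record
          { isSemigroup = record
            { isMagma = record
              { isEquivalence = ≋-isEquivalence
              ; ∙-cong = λ {p₁} {p₂} {p₁'} {p₂'} eq eq' → ≋-trans (*ₚ-congˡ p₁ eq')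
                  (≋-trans (*ₚ-comm p₁ p₂') (≋-trans (*ₚ-congˡ p₂' eq) (*ₚ-comm p₂' p₂)))
              }
            ; assoc = *ₚ-assoc
            }
          ; identity = *ₚ-identityˡ , (λ p → ≋-trans (*ₚ-comm p (oneS r)) (*ₚ-identityˡ p))
          }
        ; comm = *ₚ-comm
        }
      ; distribʳ = *ₚ-distribʳ-++
      ; zeroˡ = λ p → ≡⇒≋ ≡.refl
      }
    }

-- X and e as weighted sums

unit : ∀ {r} → Fin r → Vec ℕ r
unit c = tabulate (λ d → b2n ⌊ c ≟F d ⌋)

unit-suc : ∀ {r} (c : Fin r) → unit (F.suc c) ≡ 0 ∷ unit c
unit-suc c = cong (0 ∷_) (V.tabulate-cong λ d →
  cong b2n (≡.trans (isYes≗does (F.suc c ≟F F.suc d)) (≡.sym (isYes≗does (c ≟F d)))))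

-- Definitionally `content G κ`, but free of the graph, so that recursion on the colouring is
-- possible.
colours : ∀ {r n} → Vec (Fin r) n → Vec ℕ r
colours κ = tabulate (λ c → length (filterᵇ (λ i → ⌊ i ≟F c ⌋) (V.toList κ)))

tabulate-0 : ∀ n → tabulate {n = n} (λ _ → 0) ≡ replicate n 0
tabulate-0 zero = ≡.refl
tabulate-0 (suc n) = cong (0 ∷_) (tabulate-0 n)

zipWith-tabulate : ∀ {n} (f g : Fin n → ℕ) →
  zipWith ℕ._+_ (tabulate f) (tabulate g) ≡ tabulate (λ i → f i ℕ.+ g i)
zipWith-tabulate {zero} f g = ≡.refl
zipWith-tabulate {suc n} f g = cong (f F.zero ℕ.+ g F.zero ∷_) (zipWith-tabulate (f ∘ F.suc) (g ∘ F.suc))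

colours-∷ : ∀ {r n} (c : Fin r) (κ : Vec (Fin r) n) → colours (c ∷ κ) ≡ zipWith ℕ._+_ (unit c) (colours κ)
colours-∷ c κ = ≡.sym (≡.trans (zipWith-tabulate _ _) (V.tabulate-cong λ d → count d))
  where
  count : ∀ d → b2n ⌊ c ≟F d ⌋ ℕ.+ length (filterᵇ (λ i → ⌊ i ≟F d ⌋) (V.toList κ))
    ≡ length (filterᵇ (λ i → ⌊ i ≟F d ⌋) (c ∷ V.toList κ))
  count d with ⌊ c ≟F d ⌋
  ... | true = ≡.refl
  ... | false = ≡.refl

-- The number `s` of exponent vectors is independent of the number `r` of variables, so an induction
-- can drop a vector without changing the polynomial ring.
selected : ∀ {r s} → (Fin s → Vec ℕ r) → Vec Bool s → Vec ℕ r
selected y [] = replicate _ 0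
selected y (true ∷ S) = zipWith ℕ._+_ (y F.zero) (selected (y ∘ F.suc) S)
selected y (false ∷ S) = selected (y ∘ F.suc) S

selected-0∷ : ∀ {r s} {y : Fin s → Vec ℕ (suc r)} (y' : Fin s → Vec ℕ r) → (∀ i → y i ≡ 0 ∷ y' i) →
  ∀ S → selected y S ≡ 0 ∷ selected y' S
selected-0∷ y' y≡ [] = ≡.refl
selected-0∷ y' y≡ (true ∷ S) rewrite y≡ F.zero | selected-0∷ (y' ∘ F.suc) (y≡ ∘ F.suc) S = ≡.refl
selected-0∷ y' y≡ (false ∷ S) = selected-0∷ (y' ∘ F.suc) (y≡ ∘ F.suc) S

selected-unit : ∀ {r} (S : Vec Bool r) → selected unit S ≡ V.map b2n S
selected-unit [] = ≡.refl
selected-unit {suc r} (b ∷ S) = head b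
  where
  tail : selected (λ i → unit (F.suc i)) S ≡ 0 ∷ V.map b2n S
  tail = ≡.trans (selected-0∷ {y = λ i → unit (F.suc i)} unit unit-suc S) (cong (0 ∷_) (selected-unit S))
  head : ∀ b → selected unit (b ∷ S) ≡ b2n b ∷ V.map b2n S
  head false = tail
  head true rewrite tail = cong (1 ∷_)
    (≡.trans (cong (λ α → zipWith ℕ._+_ α (V.map b2n S)) (tabulate-0 r)) (V.zipWith-identityˡ ℕ.+-identityˡ _))

module Specialised (r : ℕ) where
  open CommutativeSemiring (polySemiring r) hiding (zero)
  open Transfer (polySemiring r) (qpow 1 r) public
  open ListSum +-commutativeMonoid using (listSum; listSum-cong; listSum-map; listSum-concatMap; listSum-tabulate)
  open MonoidSum *-commutativeMonoid using () renaming (sum to prod)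
  open SetoidReasoning setoid

  *-distribˡ-listSum : ∀ {B : Set} a (f : B → Poly r) xs → a * listSum f xs ≈ listSum (λ x → a * f x) xs
  *-distribˡ-listSum a f [] = zeroʳ a
  *-distribˡ-listSum a f (x ∷ xs) = trans (distribˡ a (f x) (listSum f xs)) (+-congˡ (*-distribˡ-listSum a f xs))

  map-filterᵇ : ∀ {B : Set} (f : B → ℤ × Mon r) p xs →
    map f (filterᵇ p xs) ≡ listSum (λ x → if p x then f x ∷ [] else []) xs
  map-filterᵇ f p [] = ≡.refl
  map-filterᵇ f p (x ∷ xs) with p x
  ... | true = cong (f x ∷_) (map-filterᵇ f p xs)
  ... | false = map-filterᵇ f p xs

  mono : Vec ℕ r → Poly r
  mono α = (+ 1 , α , 0) ∷ []

  x : Fin r → Poly r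
  x i = mono (unit i)

  qpow-pow : ∀ k → qpow k r ≈ pow k
  qpow-pow zero = refl
  qpow-pow (suc k) = begin
    qpow (suc k) r        ≡⟨ cong (λ α → (+ 1 , α , suc k) ∷ []) (≡.sym (V.zipWith-identityˡ ℕ.+-identityˡ (replicate r 0))) ⟩
    qpow 1 r * qpow k r   ≈⟨ *-congˡ {qpow 1 r} (qpow-pow k) ⟩
    pow (suc k)           ∎

  Σ<-Sum : ∀ n f → Σ< n f r ≈ Sum n (λ i → f i r)
  Σ<-Sum zero f = refl
  Σ<-Sum (suc n) f = +-congʳ (Σ<-Sum n f)

  qint-int : ∀ k → qint k r ≈ int k
  qint-int zero = refl
  qint-int (suc k) = +-cong (qint-int k) (qpow-pow k)

  qfact-fact : ∀ k → qfact k r ≈ fact k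
  qfact-fact zero = refl
  qfact-fact (suc k) = *-cong (qfact-fact k) (qint-int (suc k))

  subsetTerm : ∀ {s} → (Fin s → Vec ℕ r) → ℕ → Vec Bool s → Poly r
  subsetTerm y k S = if countB S ≡ᵇ k then mono (selected y S) else []

  subsetTerm-true : ∀ {s} (y : Fin (suc s) → Vec ℕ r) k S →
    subsetTerm y (suc k) (true ∷ S) ≈ mono (y F.zero) * subsetTerm (y ∘ F.suc) k S
  subsetTerm-true y k S with countB S ≡ᵇ k
  ... | true = refl
  ... | false = sym (zeroʳ (mono (y F.zero)))

  subsets : ∀ s → List (Vec Bool s)
  subsets = vecsOver (true ∷ false ∷ [])

  listSum-subsets : ∀ {s} (f : Vec Bool (suc s) → Poly r) →
    listSum f (subsets (suc s)) ≈ listSum (λ S → f (true ∷ S)) (subsets s) + listSum (λ S → f (false ∷ S)) (subsets s)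
  listSum-subsets {s} f = trans (listSum-concatMap f (λ a → map (a ∷_) (subsets s)) (true ∷ false ∷ []))
    (+-cong (listSum-map f _ (subsets s)) (trans (+-identityʳ _) (listSum-map f _ (subsets s))))

  listSum-0 : ∀ {B : Set} (xs : List B) → listSum (λ _ → []) xs ≈ []
  listSum-0 [] = refl
  listSum-0 (_ ∷ xs) = listSum-0 xs

  listSum-elem : ∀ s (y : Fin s → Vec ℕ r) k → listSum (subsetTerm y k) (subsets s) ≈ elem (mono ∘ y) k
  listSum-elem zero y zero = refl
  listSum-elem zero y (suc k) = refl
  listSum-elem (suc s) y zero = trans (listSum-subsets (subsetTerm y 0))
    (+-cong (listSum-0 (subsets s)) (listSum-elem s (y ∘ F.suc) zero))
  listSum-elem (suc s) y (suc k) = begin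
    listSum (subsetTerm y (suc k)) (subsets (suc s))
      ≈⟨ listSum-subsets (subsetTerm y (suc k)) ⟩
    listSum (λ S → subsetTerm y (suc k) (true ∷ S)) (subsets s) + listSum (subsetTerm (y ∘ F.suc) (suc k)) (subsets s)
      ≈⟨ +-cong (trans (listSum-cong (subsetTerm-true y k) (subsets s)) (sym (*-distribˡ-listSum (mono (y F.zero)) (subsetTerm (y ∘ F.suc) k) (subsets s))))
           (listSum-elem s (y ∘ F.suc) (suc k)) ⟩
    mono (y F.zero) * listSum (subsetTerm (y ∘ F.suc) k) (subsets s) + elem (mono ∘ y ∘ F.suc) (suc k)
      ≈⟨ +-congʳ {elem (mono ∘ y ∘ F.suc) (suc k)} (*-congˡ {mono (y F.zero)} (listSum-elem s (y ∘ F.suc) k)) ⟩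
    elem (mono ∘ y) (suc k) ∎

  e-elem : ∀ k → e k r ≈ elem x k
  e-elem k = begin
    e k r                                          ≡⟨ map-filterᵇ _ _ (subsets r) ⟩
    listSum (λ S → if countB S ≡ᵇ k then mono (V.map b2n S) else []) (subsets r)
      ≈⟨ listSum-cong (λ S → reflexive (cong (λ α → if countB S ≡ᵇ k then mono α else []) (≡.sym (selected-unit S)))) (subsets r) ⟩
    listSum (subsetTerm unit k) (subsets r)        ≈⟨ listSum-elem r unit k ⟩
    elem x k                                       ∎

  listSum-vecsOver : ∀ n (f : Vec (Fin r) n → Poly r) → listSum f (vecsOver (allFin r) n) ≈ sumVec n f
  listSum-vecsOver zero f = +-identityʳ (f [])
  listSum-vecsOver (suc n) f = begin
    listSum f (concatMap (λ a → map (a ∷_) (vecsOver (allFin r) n)) (allFin r))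
      ≈⟨ listSum-concatMap f _ (allFin r) ⟩
    listSum (λ a → listSum f (map (a ∷_) (vecsOver (allFin r) n))) (allFin r)
      ≈⟨ listSum-tabulate (λ a → listSum f (map (a ∷_) (vecsOver (allFin r) n))) {r} id ⟩
    sum (λ a → listSum f (map (a ∷_) (vecsOver (allFin r) n)))
      ≈⟨ sum-cong-≋ (λ a → trans (listSum-map f (a ∷_) (vecsOver (allFin r) n)) (listSum-vecsOver n (f ∘ (a ∷_)))) ⟩
    sumVec (suc n) f ∎

  mono-colours : ∀ {n} (κ : Vec (Fin r) n) → mono (colours κ) ≈ prod (λ j → x (lookup κ j))
  mono-colours [] = reflexive (cong mono (tabulate-0 r))
  mono-colours (c ∷ κ) = trans (reflexive (cong mono (colours-∷ c κ))) (*-congˡ {x c} (mono-colours κ))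

  X-term : ∀ b α s → (if b then (+ 1 , α , s) ∷ [] else []) ≈ mono α * (if b then pow s else [])
  X-term false α s = sym (zeroʳ (mono α))
  X-term true α s = begin
    (+ 1 , α , s) ∷ []   ≡⟨ cong (λ α → (+ 1 , α , s) ∷ []) (≡.sym (V.zipWith-identityʳ ℕ.+-identityʳ α)) ⟩
    mono α * qpow s r    ≈⟨ *-congˡ {mono α} (qpow-pow s) ⟩
    mono α * pow s       ∎

  X-Z : ∀ G → X G r ≈ Z (edge G) (N G) (λ _ → x)
  X-Z G = begin
    X G r
      ≡⟨ map-filterᵇ _ (proper G) (vecsOver (allFin r) n) ⟩
    listSum (λ κ → if proper G κ then (+ 1 , content G κ , asc G κ) ∷ [] else []) (vecsOver (allFin r) n)
      ≈⟨ listSum-vecsOver n _ ⟩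
    sumVec n (λ κ → if proper G κ then (+ 1 , content G κ , asc G κ) ∷ [] else [])
      ≈⟨ sumVec-cong n (λ κ → trans (X-term (proper G κ) (colours κ) (asc G κ)) (*-cong (mono-colours κ) (colouringWeight E κ))) ⟩
    sumVec n (λ κ → prod (λ j → x (lookup κ j)) * edgeProduct E κ)
      ≈⟨ Z-expand E n (λ _ → x) ⟨
    Z E n (λ _ → x) ∎
    where
    n = N G
    E = edge G

-- Symmetric functions

open Defs using (_≈_)
open import Data.Nat.Base using (_+_; _*_)

infix 4 _≅_
record _≅_ (f g : SymF) : Set where
  constructor ≅-intro
  field at : ∀ r → f r ≋ g r
open _≅_ public

≅⇒≈ : ∀ {f g} → f ≅ g → f ≈ g
≅⇒≈ f≅g r = coeffs (at f≅g r)

module Poly r = CommutativeSemiring (polySemiring r)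

≅-isEquivalence : IsEquivalence _≅_
≅-isEquivalence = record
  { refl = ≅-intro λ r → Poly.refl r
  ; sym = λ eq → ≅-intro λ r → Poly.sym r (at eq r)
  ; trans = λ eq eq' → ≅-intro λ r → Poly.trans r (at eq r) (at eq' r)
  }

symSemiring : CommutativeSemiring 0ℓ 0ℓ
symSemiring = record
  { Carrier = SymF
  ; _≈_ = _≅_
  ; _+_ = _⊕_
  ; _*_ = _⊗_
  ; 0# = zeroS
  ; 1# = oneS
  ; isCommutativeSemiring = isCommutativeSemiringˡ record
    { +-isCommutativeMonoid = record
      { isMonoid = record
        { isSemigroup = record
          { isMagma = record
            { isEquivalence = ≅-isEquivalence
            ; ∙-cong = λ eq eq' → ≅-intro λ r → Poly.+-cong r (at eq r) (at eq' r)
            }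
          ; assoc = λ f g h → ≅-intro λ r → Poly.+-assoc r (f r) (g r) (h r)
          }
        ; identity = (λ f → ≅-intro λ r → Poly.+-identityˡ r (f r)) , (λ f → ≅-intro λ r → Poly.+-identityʳ r (f r))
        }
      ; comm = λ f g → ≅-intro λ r → Poly.+-comm r (f r) (g r)
      }
    ; *-isCommutativeMonoid = record
      { isMonoid = record
        { isSemigroup = record
          { isMagma = record
            { isEquivalence = ≅-isEquivalence
            ; ∙-cong = λ eq eq' → ≅-intro λ r → Poly.*-cong r (at eq r) (at eq' r)
            }
          ; assoc = λ f g h → ≅-intro λ r → Poly.*-assoc r (f r) (g r) (h r)
          }
        ; identity = (λ f → ≅-intro λ r → Poly.*-identityˡ r (f r)) , (λ f → ≅-intro λ r → Poly.*-identityʳ r (f r))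
        }
      ; comm = λ f g → ≅-intro λ r → Poly.*-comm r (f r) (g r)
      }
    ; distribʳ = λ h f g → ≅-intro λ r → Poly.distribʳ r (h r) (f r) (g r)
    ; zeroˡ = λ f → ≅-intro λ r → Poly.zeroˡ r (f r)
    }
  }

module Sym = CommutativeSemiring symSemiring

⊗-congˡ : ∀ f {g h} → g ≅ h → f ⊗ g ≅ f ⊗ h
⊗-congˡ f = Sym.*-congˡ {f}

⊗-congʳ : ∀ f {g h} → g ≅ h → g ⊗ f ≅ h ⊗ f
⊗-congʳ f = Sym.*-congʳ {f}

-- The formulas as identities of symmetric functions

X-path : ∀ n → X (P (suc n)) ≅ qint (suc n) ⊗ e (suc n) ⊕ Σ< n (λ i → q ⊗ qint i ⊗ X (P (n ∸ i)) ⊗ e (suc i))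
X-path n = ≅-intro λ r →
  let open Specialised r
      open CommutativeSemiring (polySemiring r) using (trans; sym; refl; +-cong; *-cong)
  in trans (X-Z (P (suc n))) (trans (Z-pathSum (suc n) x) (trans (W-elem x n 0) (sym
       (+-cong (*-cong (qint-int (suc n)) (e-elem (suc n)))
         (trans (Σ<-Sum n _) (Sum-cong n λ i _ →
           *-cong (*-cong (*-cong (refl {q r}) (qint-int i)) (trans (X-Z (P (n ∸ i))) (Z-pathSum (n ∸ i) x))) (e-elem (suc i))))))))

-- Writing m as `2 + N` removes the truncated subtractions from m.
X-melt : ∀ N n k → k ≤ suc N →
  X (MeltingLollipop (2 + N) n k)
    ≅ qint (suc N ∸ k) ⊗ qfact N
        ⊗ (qint (2 + N + n) ⊗ e (2 + N + n)
           ⊕ Σ< n (λ i → q ⊗ qint (suc N + i) ⊗ X (P (n ∸ i)) ⊗ e (2 + N + i)))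
      ⊕ qpow (suc N ∸ k) ⊗ qint k ⊗ qfact N ⊗ X (P (suc n)) ⊗ e (suc N)
X-melt N n k k≤1+N = ≅-intro λ r →
  let open Specialised r
      open CommutativeSemiring (polySemiring r) using (trans; sym; refl; +-cong; *-cong)
      path : ∀ n → X (P n) r ≋ pathSum x n
      path n = trans (X-Z (P n)) (Z-pathSum n x)
  in trans (X-Z (MeltingLollipop (2 + N) n k)) (trans (Z-melt-formula N k k≤1+N n x) (sym
       (+-cong
         (*-cong (*-cong (qint-int (suc N ∸ k)) (qfact-fact N))
           (+-cong (*-cong (qint-int (2 + N + n)) (e-elem (2 + N + n)))
             (trans (Σ<-Sum n _) (Sum-cong n λ i _ →
               *-cong (*-cong (*-cong (refl {q r}) (qint-int (suc N + i))) (path (n ∸ i))) (e-elem (2 + N + i))))))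
         (*-cong (*-cong (*-cong (*-cong (qpow-pow (suc N ∸ k)) (qint-int k)) (qfact-fact N)) (path (suc n))) (e-elem (suc N))))))

-- Sums of q-intervals with a common centre

qpow-⊗ : ∀ s t → qpow s ⊗ qpow t ≅ qpow (s + t)
qpow-⊗ s t = ≅-intro λ r → ≡⇒≋ (cong (λ α → (+ 1 , α , s + t) ∷ []) (V.zipWith-identityˡ ℕ.+-identityˡ (replicate r 0)))

qint-⊗ : ∀ k l → qint (suc k) ⊗ qint (suc l) ≅ qint (suc (k + l)) ⊕ q ⊗ (qint k ⊗ qint l)
qint-⊗ k l = ≅-intro λ r →
  let open Specialised r
      open CommutativeSemiring (polySemiring r) using (trans; sym; refl; +-cong; *-cong)
  in trans (*-cong (qint-int (suc k)) (qint-int (suc l))) (trans (int-* k l) (sym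
       (+-cong (qint-int (suc (k + l))) (*-cong (refl {q r}) (*-cong (qint-int k) (qint-int l))))))

eλ-++ : ∀ κs λs → eλ (κs ++ λs) ≅ eλ κs ⊗ eλ λs
eλ-++ [] λs = Sym.sym (Sym.*-identityˡ (eλ λs))
eλ-++ (k ∷ κs) λs = Sym.trans (⊗-congˡ (e k) (eλ-++ κs λs)) (Sym.sym (Sym.*-assoc (e k) (eλ κs) (eλ λs)))

-- Sums of terms q^s [l + 1] e_λ, whose coefficients are 1 exactly in the
-- degrees s, …, s + l; all these intervals have the same centre d / 2.
data ChainSum (d : ℕ) : SymF → Set where
  chain : ∀ s l λs → s + s + l ≡ d → ChainSum d (qpow s ⊗ qint (suc l) ⊗ eλ λs)
  empty : ChainSum d zeroS
  _∪_   : ∀ {f g} → ChainSum d f → ChainSum d g → ChainSum d (f ⊕ g)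
  resp  : ∀ {f g} → f ≅ g → ChainSum d f → ChainSum d g

open Solver symSemiring using (solve; _:=_; _:+_; _:*_; con)

-- An analogue of the Clebsch-Gordan rule. Each use of `qint-⊗` splits off one chain, raises `s` by
-- one and lowers `k` and `l` by one each, so `s + s + (k + l)` is unchanged; it stops when a factor
-- becomes [0].
chain-product : ∀ {d} s k l λs → s + s + (k + l) ≡ d → ChainSum d (qpow s ⊗ (qint (suc k) ⊗ qint (suc l)) ⊗ eλ λs)
chain-product s k l λs eq = resp (Sym.sym split) (chain s (k + l) λs eq ∪ rest k l eq)
  where
  open SetoidReasoning Sym.setoid
  split : qpow s ⊗ (qint (suc k) ⊗ qint (suc l)) ⊗ eλ λs
    ≅ qpow s ⊗ qint (suc (k + l)) ⊗ eλ λs ⊕ qpow (suc s) ⊗ (qint k ⊗ qint l) ⊗ eλ λs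
  split = begin
    qpow s ⊗ (qint (suc k) ⊗ qint (suc l)) ⊗ eλ λs
      ≈⟨ ⊗-congʳ (eλ λs) (⊗-congˡ (qpow s) (qint-⊗ k l)) ⟩
    qpow s ⊗ (qint (suc (k + l)) ⊕ q ⊗ (qint k ⊗ qint l)) ⊗ eλ λs
      ≈⟨ solve 5 (λ w i q j e → w :* (i :+ q :* j) :* e := w :* i :* e :+ (q :* w) :* j :* e) Sym.refl (qpow s) (qint (suc (k + l))) q (qint k ⊗ qint l) (eλ λs) ⟩
    qpow s ⊗ qint (suc (k + l)) ⊗ eλ λs ⊕ (q ⊗ qpow s) ⊗ (qint k ⊗ qint l) ⊗ eλ λs
      ≈⟨ Sym.+-congˡ {qpow s ⊗ qint (suc (k + l)) ⊗ eλ λs} (⊗-congʳ (eλ λs) (⊗-congʳ (qint k ⊗ qint l) (qpow-⊗ 1 s))) ⟩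
    qpow s ⊗ qint (suc (k + l)) ⊗ eλ λs ⊕ qpow (suc s) ⊗ (qint k ⊗ qint l) ⊗ eλ λs ∎
  rest : ∀ k l → s + s + (k + l) ≡ _ → ChainSum _ (qpow (suc s) ⊗ (qint k ⊗ qint l) ⊗ eλ λs)
  rest zero l eq = resp (solve 3 (λ w j e → con 0 := w :* (con 0 :* j) :* e) Sym.refl (qpow (suc s)) (qint l) (eλ λs)) empty
  rest (suc k) zero eq = resp (solve 3 (λ w j e → con 0 := w :* (j :* con 0) :* e) Sym.refl (qpow (suc s)) (qint (suc k)) (eλ λs)) empty
  rest (suc k) (suc l) eq = chain-product (suc s) k l λs (≡.trans (lem s k l) eq)
    where
    lem : ∀ s k l → suc s + suc s + (k + l) ≡ s + s + (suc k + suc l)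
    lem = ℕ-Solver.solve-∀

-- Distributivity reduces the claim to two single chains. There the powers of `q` and the partitions
-- merge, and `chain-product` expands the product of the two q-integers.
_⊠_ : ∀ {a b f g} → ChainSum a f → ChainSum b g → ChainSum (a + b) (f ⊗ g)
_⊠_ {g = g} empty V = resp (Sym.sym (Sym.zeroˡ g)) empty
_⊠_ {g = h} (_∪_ {f} {g} U U') V = resp (Sym.sym (Sym.distribʳ h f g)) ((U ⊠ V) ∪ (U' ⊠ V))
_⊠_ {g = h} (resp eq U) V = resp (⊗-congʳ h eq) (U ⊠ V)
_⊠_ {f = f} (chain _ _ _ _) empty = resp (Sym.sym (Sym.zeroʳ f)) empty
_⊠_ {f = h} U@(chain _ _ _ _) (_∪_ {f} {g} V V') = resp (Sym.sym (Sym.distribˡ h f g)) ((U ⊠ V) ∪ (U ⊠ V'))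
_⊠_ {f = h} U@(chain _ _ _ _) (resp eq V) = resp (⊗-congˡ h eq) (U ⊠ V)
chain s k κs ≡.refl ⊠ chain t l λs ≡.refl = resp merge (chain-product (s + t) k l (κs ++ λs) (lem s t k l))
  where
  open SetoidReasoning Sym.setoid
  lem : ∀ s t k l → (s + t) + (s + t) + (k + l) ≡ s + s + k + (t + t + l)
  lem = ℕ-Solver.solve-∀
  merge : qpow (s + t) ⊗ (qint (suc k) ⊗ qint (suc l)) ⊗ eλ (κs ++ λs)
    ≅ (qpow s ⊗ qint (suc k) ⊗ eλ κs) ⊗ (qpow t ⊗ qint (suc l) ⊗ eλ λs)
  merge = begin
    qpow (s + t) ⊗ (qint (suc k) ⊗ qint (suc l)) ⊗ eλ (κs ++ λs)
      ≈⟨ Sym.*-cong (⊗-congʳ (qint (suc k) ⊗ qint (suc l)) (Sym.sym (qpow-⊗ s t))) (eλ-++ κs λs) ⟩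
    (qpow s ⊗ qpow t) ⊗ (qint (suc k) ⊗ qint (suc l)) ⊗ (eλ κs ⊗ eλ λs)
      ≈⟨ solve 6 (λ s t k l a b → (s :* t) :* (k :* l) :* (a :* b) := (s :* k :* a) :* (t :* l :* b)) Sym.refl (qpow s) (qpow t) (qint (suc k)) (qint (suc l)) (eλ κs) (eλ λs) ⟩
    (qpow s ⊗ qint (suc k) ⊗ eλ κs) ⊗ (qpow t ⊗ qint (suc l) ⊗ eλ λs) ∎

qint-ChainSum : ∀ l → ChainSum l (qint (suc l))
qint-ChainSum l = resp (solve 1 (λ i → con 1 :* i :* con 1 := i) Sym.refl (qint (suc l))) (chain 0 l [] ≡.refl)

qint1 : qint 1 ≅ oneS
qint1 = ≅-intro λ r → ≡⇒≋ ≡.refl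

qpow-ChainSum : ∀ s → ChainSum (s + s) (qpow s)
qpow-ChainSum s = resp (Sym.trans (Sym.*-identityʳ (qpow s ⊗ qint 1)) (Sym.trans (⊗-congˡ (qpow s) qint1) (Sym.*-identityʳ (qpow s)))) (chain s 0 [] (ℕ.+-identityʳ (s + s)))

e-ChainSum : ∀ k → ChainSum 0 (e k)
e-ChainSum k = resp (Sym.trans (⊗-congʳ (e k ⊗ oneS) (⊗-congˡ oneS qint1)) (solve 1 (λ e → con 1 :* con 1 :* (e :* con 1) := e) Sym.refl (e k))) (chain 0 0 (k ∷ []) ≡.refl)

Σ<-ChainSum : ∀ {d} n {f} → (∀ i → i < n → ChainSum d (f i)) → ChainSum d (Σ< n f)
Σ<-ChainSum zero U = empty
Σ<-ChainSum (suc n) U = Σ<-ChainSum n (λ i i<n → U i (ℕ.m<n⇒m<1+n i<n)) ∪ U n ℕ.≤-refl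

-- The binomial coefficient k over 2, which is the q-degree of `qfact k` and also the number of
-- edges of the complete graph on k vertices.
triangle : ℕ → ℕ
triangle zero = 0
triangle (suc k) = triangle k + k

qfact-ChainSum : ∀ k → ChainSum (triangle k) (qfact k)
qfact-ChainSum zero = qpow-ChainSum 0
qfact-ChainSum (suc k) = qfact-ChainSum k ⊠ qint-ChainSum k

-- The factor `q` counts 2, being twice its centre; the q-integer counts N + i - 1 and the path n -
-- i - 1. The total N + n does not depend on `i`. If N + i = 0, the q-integer is [0] and the term
-- vanishes.
pathTerm-ChainSum : ∀ N {n} i → (∀ {j} → j < n → ChainSum j (X (P (suc j)))) → i < n →
  ChainSum (N + n) (q ⊗ qint (N + i) ⊗ X (P (n ∸ i)) ⊗ e (suc (N + i)))
pathTerm-ChainSum N {n} i U i<n with N + i in N+i≡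
... | zero = resp (solve 3 (λ q x e → con 0 := q :* con 0 :* x :* e) Sym.refl q (X (P (n ∸ i))) (e 1)) empty
... | suc l = subst (λ d → ChainSum d (q ⊗ qint (suc l) ⊗ X (P (n ∸ i)) ⊗ e (suc (suc l)))) degree
    (((qpow-ChainSum 1 ⊠ qint-ChainSum l) ⊠ subst (λ m → ChainSum j (X (P m))) (≡.sym n∸i≡) (U j<n)) ⊠ e-ChainSum (suc (suc l)))
  where
  open ≡.≡-Reasoning
  j = n ∸ suc i
  n∸i≡ : n ∸ i ≡ suc j
  n∸i≡ = ℕ.+-∸-assoc 1 i<n
  j<n : j < n
  j<n = ℕ.≤-trans (ℕ.≤-reflexive (≡.sym n∸i≡)) (ℕ.m∸n≤m n i)
  lem : ∀ l j → 2 + l + j + 0 ≡ suc l + suc j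
  lem = ℕ-Solver.solve-∀
  degree : 2 + l + j + 0 ≡ N + n
  degree = begin
    2 + l + j + 0       ≡⟨ lem l j ⟩
    suc l + suc j       ≡⟨ cong₂ _+_ (≡.sym N+i≡) (≡.sym n∸i≡) ⟩
    N + i + (n ∸ i)     ≡⟨ ℕ.+-assoc N i (n ∸ i) ⟩
    N + (i + (n ∸ i))   ≡⟨ cong (λ m → N + m) (ℕ.m+[n∸m]≡n (ℕ.<⇒≤ i<n)) ⟩
    N + n               ∎

path-ChainSum : ∀ n → ChainSum n (X (P (suc n)))
path-ChainSum = <-rec _ λ n U → resp (Sym.sym (X-path n))
  (subst (λ d → ChainSum d (qint (suc n) ⊗ e (suc n))) (ℕ.+-identityʳ n) (qint-ChainSum n ⊠ e-ChainSum (suc n))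
   ∪ Σ<-ChainSum n (λ i i<n → pathTerm-ChainSum 0 i U i<n))

-- Let p = N + 1 - k and let t be `triangle N`. The summands have twice their centre equal to (p -
-- 1) + t + (N + 1 + n) and 2p + (k - 1) + t + n, which agree because p + k = N + 1. For p = 0 or k
-- = 0 the corresponding summand contains [0] and is zero.
melt-ChainSum : ∀ N n k → k ≤ suc N → ChainSum (n + ((suc N ∸ k) + triangle (suc N))) (X (MeltingLollipop (2 + N) n k))
melt-ChainSum N n k k≤1+N = resp (Sym.sym (X-melt N n k k≤1+N)) (first (suc N ∸ k) ∪ second k k≤1+N)
  where
  Y = qint (2 + N + n) ⊗ e (2 + N + n) ⊕ Σ< n (λ i → q ⊗ qint (suc N + i) ⊗ X (P (n ∸ i)) ⊗ e (2 + N + i))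
  Y-ChainSum : ChainSum (suc N + n) Y
  Y-ChainSum = subst (λ d → ChainSum d (qint (2 + N + n) ⊗ e (2 + N + n))) (ℕ.+-identityʳ (suc N + n)) (qint-ChainSum (suc N + n) ⊠ e-ChainSum (2 + N + n))
    ∪ Σ<-ChainSum n (λ i i<n → pathTerm-ChainSum (suc N) i (λ {j} _ → path-ChainSum j) i<n)
  first : ∀ p → ChainSum (n + (p + triangle (suc N))) (qint p ⊗ qfact N ⊗ Y)
  first zero = resp (solve 2 (λ f y → con 0 := con 0 :* f :* y) Sym.refl (qfact N) Y) empty
  first (suc p) = subst (λ d → ChainSum d (qint (suc p) ⊗ qfact N ⊗ Y)) (lem p N n (triangle N))
    ((qint-ChainSum p ⊠ qfact-ChainSum N) ⊠ Y-ChainSum)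
    where
    lem : ∀ p N n t → p + t + (suc N + n) ≡ n + (suc p + (t + N))
    lem = ℕ-Solver.solve-∀
  second : ∀ k → k ≤ suc N → ChainSum (n + ((suc N ∸ k) + triangle (suc N)))
    (qpow (suc N ∸ k) ⊗ qint k ⊗ qfact N ⊗ X (P (suc n)) ⊗ e (suc N))
  second zero _ = resp (solve 4 (λ w f x e → con 0 := w :* con 0 :* f :* x :* e) Sym.refl (qpow (suc N)) (qfact N) (X (P (suc n))) (e (suc N))) empty
  second (suc k) (s≤s k≤N) = subst (λ d → ChainSum d (qpow p ⊗ qint (suc k) ⊗ qfact N ⊗ X (P (suc n)) ⊗ e (suc N)))
    (≡.trans (lem p k n (triangle N)) (cong (λ M → n + (p + (triangle N + M))) (ℕ.m∸n+n≡m k≤N)))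
    ((((qpow-ChainSum p ⊠ qint-ChainSum k) ⊠ qfact-ChainSum N) ⊠ path-ChainSum n) ⊠ e-ChainSum (suc N))
    where
    p = N ∸ k
    lem : ∀ p k n t → p + p + k + t + n + 0 ≡ n + (p + (t + (p + k)))
    lem = ℕ-Solver.solve-∀

-- Coefficients of chains: positivity, symmetry and unimodality

coeff-coeffQ : ∀ t f r α s → coeff (coeffQ t f r) (α , s) ≡ (if s ≡ᵇ 0 then coeff (f r) (α , t) else + 0)
coeff-coeffQ t f r α s = slice (f r) s
  where
  slice : ∀ (p : Poly r) s →
    coeff (map (λ { (c , α , s) → (c , α , 0) }) (filterᵇ (λ { (c , α , s) → s ≡ᵇ t }) p)) (α , s)
      ≡ (if s ≡ᵇ 0 then coeff p (α , t) else + 0)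
  slice [] zero = ≡.refl
  slice [] (suc s) = ≡.refl
  slice ((c , β , u) ∷ p) s with u ≡ᵇ t
  slice ((c , β , u) ∷ p) s | false rewrite ∧-zeroʳ ⌊ V.≡-dec ℕ._≟_ β α ⌋ =
    ≡.trans (slice p s) (cong (if s ≡ᵇ 0 then_else + 0) (≡.sym (ℤ.+-identityˡ (coeff p (α , t)))))
  slice ((c , β , u) ∷ p) zero | true = cong (ℤ._+_ (if ⌊ V.≡-dec ℕ._≟_ β α ⌋ ∧ true then c else + 0)) (slice p zero)
  slice ((c , β , u) ∷ p) (suc s) | true rewrite ∧-zeroʳ ⌊ V.≡-dec ℕ._≟_ β α ⌋ =
    ≡.trans (ℤ.+-identityˡ _) (slice p (suc s))

coeff-neg : ∀ f r μ → coeff (neg f r) μ ≡ ℤ.- coeff (f r) μ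
coeff-neg f r μ = go (f r)
  where
  negate : ℤ × Mon r → ℤ × Mon r
  negate (c , ν) = ℤ.- c , ν
  go : ∀ (p : Poly r) → coeff (map negate p) μ ≡ ℤ.- coeff p μ
  go [] = ≡.refl
  go ((c , ν) ∷ p) rewrite go p with monEq ν μ
  ... | true = ≡.sym (ℤ.neg-distrib-+ c (coeff p μ))
  ... | false = ≡.trans (ℤ.+-identityˡ _) (cong ℤ.-_ (≡.sym (ℤ.+-identityˡ (coeff p μ))))

QFree : ∀ {r} → Poly r → Set
QFree = All (λ (c , α , s) → s ≡ 0)

*ₚ-QFree : ∀ {r} {p p' : Poly r} → QFree p → QFree p' → QFree (p *ₚ p')
*ₚ-QFree [] free' = []
*ₚ-QFree (≡.refl ∷ free) free' = All.++⁺ (All.map⁺ free') (*ₚ-QFree free free')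

eλ-QFree : ∀ λs r → QFree (eλ λs r)
eλ-QFree [] r = ≡.refl ∷ []
eλ-QFree (k ∷ λs) r = *ₚ-QFree (e-QFree (vecsOver (true ∷ false ∷ []) r)) (eλ-QFree λs r)
  where
  e-QFree : ∀ Ss → QFree (map (λ S → (+ 1 , V.map b2n S , 0)) (filterᵇ (λ S → countB S ≡ᵇ k) Ss))
  e-QFree Ss = All.map⁺ (All.universal (λ _ → ≡.refl) _)

eΛ : List (List ℕ) → SymF
eΛ = foldr (λ λs h → eλ λs ⊕ h) zeroS

eΛ-QFree : ∀ Λ r → QFree (eΛ Λ r)
eΛ-QFree [] r = []
eΛ-QFree (λs ∷ Λ) r = All.++⁺ (eλ-QFree λs r) (eΛ-QFree Λ r)

eΛ-++ : ∀ Λ Λ' → eΛ (Λ ++ Λ') ≅ eΛ Λ ⊕ eΛ Λ'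
eΛ-++ [] Λ' = Sym.refl
eΛ-++ (λs ∷ Λ) Λ' = Sym.trans (Sym.+-congˡ {eλ λs} (eΛ-++ Λ Λ')) (Sym.sym (Sym.+-assoc (eλ λs) (eΛ Λ) (eΛ Λ')))

coeff-QFree : ∀ {r} {p : Poly r} → QFree p → ∀ α s → coeff p (α , s) ≡ (if s ≡ᵇ 0 then coeff p (α , 0) else + 0)
coeff-QFree [] α zero = ≡.refl
coeff-QFree [] α (suc s) = ≡.refl
coeff-QFree (≡.refl ∷ free) α zero = ≡.refl
coeff-QFree {p = (c , β , _) ∷ p} (≡.refl ∷ free) α (suc s) rewrite ∧-zeroʳ ⌊ V.≡-dec ℕ._≟_ β α ⌋ =
  ≡.trans (ℤ.+-identityˡ _) (coeff-QFree free α (suc s))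

coeff-qpow-⊗ : ∀ s λs r α t → coeff ((qpow s ⊗ eλ λs) r) (α , t) ≡ (if s ≡ᵇ t then coeff (eλ λs r) (α , 0) else + 0)
coeff-qpow-⊗ s λs r α t = ≡.trans (cong (λ p → coeff p (α , t)) (L.++-identityʳ (map term (eλ λs r)))) (go (eλ-QFree λs r))
  where
  term : ℤ × Mon r → ℤ × Mon r
  term (d , ν) = + 1 ℤ.* d , monMul (replicate r 0 , s) ν
  term-≡ : ∀ d β → term (d , β , 0) ≡ (d , β , s)
  term-≡ d β = cong₂ _,_ (ℤ.*-identityˡ d) (cong₂ _,_ (V.zipWith-identityˡ ℕ.+-identityˡ β) (ℕ.+-identityʳ s))
  go : ∀ {p : Poly r} → QFree p → coeff (map term p) (α , t) ≡ (if s ≡ᵇ t then coeff p (α , 0) else + 0)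
  go [] with s ≡ᵇ t
  ... | true = ≡.refl
  ... | false = ≡.refl
  go {(d , β , _) ∷ p} (≡.refl ∷ free) = ≡.trans
    (cong (λ τ → coeff (τ ∷ map term p) (α , t)) (term-≡ d β))
    (≡.trans (cong (ℤ._+_ (if monEq (β , s) (α , t) then d else + 0)) (go free)) (merge (s ≡ᵇ t)))
    where
    β≟α = ⌊ V.≡-dec ℕ._≟_ β α ⌋
    merge : ∀ b → (if β≟α ∧ b then d else + 0) ℤ.+ (if b then coeff p (α , 0) else + 0)
      ≡ (if b then (if β≟α ∧ true then d else + 0) ℤ.+ coeff p (α , 0) else + 0)
    merge true = ≡.refl
    merge false rewrite ∧-zeroʳ β≟α = ≡.refl

chain-zero : ∀ s λs → qpow s ⊗ qint 1 ⊗ eλ λs ≅ qpow s ⊗ eλ λs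
chain-zero s λs = ⊗-congʳ (eλ λs) (Sym.trans (⊗-congˡ (qpow s) qint1) (Sym.*-identityʳ (qpow s)))

chain-suc : ∀ s l λs → qpow s ⊗ qint (2 + l) ⊗ eλ λs ≅ qpow s ⊗ qint (suc l) ⊗ eλ λs ⊕ qpow (s + suc l) ⊗ eλ λs
chain-suc s l λs = Sym.trans
  (solve 4 (λ w i v e → w :* (i :+ v) :* e := w :* i :* e :+ (w :* v) :* e) Sym.refl (qpow s) (qint (suc l)) (qpow (suc l)) (eλ λs))
  (Sym.+-congˡ {qpow s ⊗ qint (suc l) ⊗ eλ λs} (⊗-congʳ (eλ λs) (qpow-⊗ s (suc l))))

≡ᵇ-true : ∀ m → (m ≡ᵇ m) ≡ true
≡ᵇ-true m = Equivalence.to T-≡ (ℕ.≡⇒≡ᵇ m m ≡.refl)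

≡ᵇ-false : ∀ {m n} → m < n ⊎ n < m → (m ≡ᵇ n) ≡ false
≡ᵇ-false {m} {n} m≢n with m ≡ᵇ n in eq
... | false = ≡.refl
... | true with ≡.refl ← ℕ.≡ᵇ⇒≡ m n (Equivalence.from T-≡ eq) with m≢n
...   | inj₁ m<m = contradiction m<m (ℕ.<-irrefl ≡.refl)
...   | inj₂ m<m = contradiction m<m (ℕ.<-irrefl ≡.refl)

module _ (s t : ℕ) (a : ℤ) where
  private
    shrink : ∀ l → t < s ⊎ s + suc l < t → t < s ⊎ s + l < t
    shrink l (inj₁ t<s) = inj₁ t<s
    shrink l (inj₂ s+1+l<t) = inj₂ (ℕ.<-trans (ℕ.+-monoʳ-< s (ℕ.n<1+n l)) s+1+l<t)

    last≢ : ∀ l → t < s ⊎ s + l < t → s + l < t ⊎ t < s + l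
    last≢ l (inj₁ t<s) = inj₂ (ℕ.<-≤-trans t<s (ℕ.m≤m+n s l))
    last≢ l (inj₂ s+l<t) = inj₁ s+l<t

  -- The coefficient of q^t in a q^s [l+1], accumulated from the lowest degree in the same way as
  -- `qint`.
  indicator : ℕ → ℤ
  indicator zero = if s + 0 ≡ᵇ t then a else + 0
  indicator (suc l) = indicator l ℤ.+ (if s + suc l ≡ᵇ t then a else + 0)

  indicator-outside : ∀ l → t < s ⊎ s + l < t → indicator l ≡ + 0
  indicator-outside zero out rewrite ≡ᵇ-false (last≢ 0 out) = ≡.refl
  indicator-outside (suc l) out
    rewrite indicator-outside l (shrink l out) | ≡ᵇ-false (last≢ (suc l) out) = ≡.refl

  indicator-inside : ∀ l → s ≤ t → t ≤ s + l → indicator l ≡ a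
  indicator-inside zero s≤t t≤s+0
    rewrite ℕ.≤-antisym (subst (_≤ t) (≡.sym (ℕ.+-identityʳ s)) s≤t) t≤s+0 | ≡ᵇ-true t = ≡.refl
  indicator-inside (suc l) s≤t t≤s+1+l with ℕ.m≤n⇒m<n∨m≡n t≤s+1+l
  ... | inj₁ t<s+1+l rewrite ≡ᵇ-false {s + suc l} {t} (inj₂ t<s+1+l) =
    ≡.trans (ℤ.+-identityʳ _) (indicator-inside l s≤t (ℕ.≤-pred (subst (t <_) (ℕ.+-suc s l) t<s+1+l)))
  ... | inj₂ t≡s+1+l
    rewrite indicator-outside l (inj₂ (subst (s + l <_) (≡.sym t≡s+1+l) (ℕ.+-monoʳ-< s (ℕ.n<1+n l))))
          | ≡.sym t≡s+1+l | ≡ᵇ-true t = ℤ.+-identityˡ a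

module _ (s : ℕ) (λs : List ℕ) (r : ℕ) (α : Vec ℕ r) (t : ℕ) where
  private
    a = coeff (eλ λs r) (α , 0)

  chainCoeff : ℕ → ℤ
  chainCoeff l = coeff ((qpow s ⊗ qint (suc l) ⊗ eλ λs) r) (α , t)

  chainCoeff-indicator : ∀ l → chainCoeff l ≡ indicator s t a l
  chainCoeff-indicator zero = ≡.trans (coeffs (at (chain-zero s λs) r) (α , t)) (≡.trans (coeff-qpow-⊗ s λs r α t)
    (cong (λ m → if m ≡ᵇ t then a else + 0) (≡.sym (ℕ.+-identityʳ s))))
  chainCoeff-indicator (suc l) = ≡.trans (coeffs (at (chain-suc s l λs) r) (α , t)) (≡.trans
    (coeff-++ ((qpow s ⊗ qint (suc l) ⊗ eλ λs) r) ((qpow (s + suc l) ⊗ eλ λs) r) (α , t))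
    (cong₂ ℤ._+_ (chainCoeff-indicator l) (coeff-qpow-⊗ (s + suc l) λs r α t)))

  chainCoeff-outside : ∀ l → t < s ⊎ s + l < t → chainCoeff l ≡ + 0
  chainCoeff-outside l out = ≡.trans (chainCoeff-indicator l) (indicator-outside s t a l out)

  chainCoeff-inside : ∀ l → s ≤ t → t ≤ s + l → chainCoeff l ≡ a
  chainCoeff-inside l s≤t t≤s+l = ≡.trans (chainCoeff-indicator l) (indicator-inside s t a l s≤t t≤s+l)

data Position (s l t : ℕ) : Set where
  below  : t < s → Position s l t
  inside : s ≤ t → t ≤ s + l → Position s l t
  above  : s + l < t → Position s l t

position : ∀ s l t → Position s l t
position s l t with t ℕ.<? s | t ℕ.≤? s + l
... | yes t<s | _ = below t<s
... | no t≮s | yes t≤s+l = inside (ℕ.≮⇒≥ t≮s) t≤s+l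
... | no t≮s | no t≰s+l = above (ℕ.≰⇒> t≰s+l)

-- Exponent 0 of `q` suffices: by `coeff-coeffQ` and `coeff-QFree` both sides of the required
-- equations vanish at all other exponents.
Represents : List (List ℕ) → (∀ r → Vec ℕ r → ℤ) → Set
Represents Λ c = ∀ r α → c r α ≡ coeff (eΛ Λ r) (α , 0)

coeffAt : ℕ → SymF → ∀ r → Vec ℕ r → ℤ
coeffAt t f r α = coeff (f r) (α , t)

coeffQ-≈ : ∀ {f g t u} → (∀ r α → coeffAt t f r α ≡ coeffAt u g r α) → coeffQ t f ≈ coeffQ u g
coeffQ-≈ {f} {g} {t} {u} eq r (α , s) = ≡.trans (coeff-coeffQ t f r α s)
  (≡.trans (cong (if s ≡ᵇ 0 then_else + 0) (eq r α)) (≡.sym (coeff-coeffQ u g r α s)))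

ChainSum-positive : ∀ {d f} → ChainSum d f → ∀ t → ∃ λ Λ → Represents Λ (coeffAt t f)
ChainSum-positive (chain s l λs _) t with position s l t
... | below t<s = [] , λ r α → chainCoeff-outside s λs r α t l (inj₁ t<s)
... | above s+l<t = [] , λ r α → chainCoeff-outside s λs r α t l (inj₂ s+l<t)
... | inside s≤t t≤s+l = (λs ∷ []) , λ r α → ≡.trans (chainCoeff-inside s λs r α t l s≤t t≤s+l)
  (cong (λ p → coeff p (α , 0)) (≡.sym (L.++-identityʳ (eλ λs r))))
ChainSum-positive empty t = [] , λ r α → ≡.refl
ChainSum-positive (_∪_ {f} {g} U V) t with ChainSum-positive U t | ChainSum-positive V t
... | Λ , eq | Λ' , eq' = Λ ++ Λ' , λ r α → ≡.trans (coeff-++ (f r) (g r) (α , t)) (≡.trans (cong₂ ℤ._+_ (eq r α) (eq' r α))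
  (≡.sym (≡.trans (coeffs (at (eΛ-++ Λ Λ') r) (α , 0)) (coeff-++ (eΛ Λ r) (eΛ Λ' r) (α , 0)))))
ChainSum-positive (resp f≅g U) t with ChainSum-positive U t
... | Λ , eq = Λ , λ r α → ≡.trans (≡.sym (coeffs (at f≅g r) (α , t))) (eq r α)

2s+l∸s : ∀ s l → s + s + l ∸ s ≡ s + l
2s+l∸s s l = ≡.trans (cong (_∸ s) (ℕ.+-assoc s s l)) (ℕ.m+n∸m≡n s (s + l))

2s+l∸[s+l] : ∀ s l → s + s + l ∸ (s + l) ≡ s
2s+l∸[s+l] s l =
  ≡.trans (cong (_∸ (s + l)) (≡.trans (ℕ.+-assoc s s l) (ℕ.+-comm s (s + l)))) (ℕ.m+n∸m≡n (s + l) s)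

-- Reflection in d/2 exchanges the ends `s` and `s + l` of each chain, so it swaps the positions
-- below and above and preserves the positions inside.
ChainSum-symmetric : ∀ {d f} → ChainSum d f → ∀ t → t ≤ d → ∀ r α → coeffAt t f r α ≡ coeffAt (d ∸ t) f r α
ChainSum-symmetric (chain s l λs ≡.refl) t t≤d r α with position s l t
... | below t<s = ≡.trans (chainCoeff-outside s λs r α t l (inj₁ t<s))
  (≡.sym (chainCoeff-outside s λs r α (s + s + l ∸ t) l
    (inj₂ (subst (_< s + s + l ∸ t) (2s+l∸s s l) (ℕ.∸-monoʳ-< t<s s≤d)))))
  where
  s≤d : s ≤ s + s + l
  s≤d = ℕ.≤-trans (ℕ.m≤m+n s s) (ℕ.m≤m+n (s + s) l)
... | above s+l<t = ≡.trans (chainCoeff-outside s λs r α t l (inj₂ s+l<t))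
  (≡.sym (chainCoeff-outside s λs r α (s + s + l ∸ t) l
    (inj₁ (subst (s + s + l ∸ t <_) (2s+l∸[s+l] s l) (ℕ.∸-monoʳ-< s+l<t t≤d)))))
... | inside s≤t t≤s+l = ≡.trans (chainCoeff-inside s λs r α t l s≤t t≤s+l)
  (≡.sym (chainCoeff-inside s λs r α (s + s + l ∸ t) l
    (subst (_≤ s + s + l ∸ t) (2s+l∸[s+l] s l) (ℕ.∸-monoʳ-≤ (s + s + l) t≤s+l))
    (subst (s + s + l ∸ t ≤_) (2s+l∸s s l) (ℕ.∸-monoʳ-≤ (s + s + l) s≤t))))
ChainSum-symmetric empty t t≤d r α = ≡.refl
ChainSum-symmetric {d} (_∪_ {f} {g} U V) t t≤d r α = ≡.trans (coeff-++ (f r) (g r) (α , t)) (≡.trans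
  (cong₂ ℤ._+_ (ChainSum-symmetric U t t≤d r α) (ChainSum-symmetric V t t≤d r α)) (≡.sym (coeff-++ (f r) (g r) (α , d ∸ t))))
ChainSum-symmetric {d} (resp f≅g U) t t≤d r α = ≡.trans (≡.sym (coeffs (at f≅g r) (α , t)))
  (≡.trans (ChainSum-symmetric U t t≤d r α) (coeffs (at f≅g r) (α , d ∸ t)))

ChainSum-vanishes : ∀ {d f} → ChainSum d f → ∀ t → d < t → ∀ r α → coeffAt t f r α ≡ + 0
ChainSum-vanishes (chain s l λs ≡.refl) t d<t r α = chainCoeff-outside s λs r α t l
  (inj₂ (ℕ.≤-<-trans (ℕ.+-monoˡ-≤ l (ℕ.m≤m+n s s)) d<t))
ChainSum-vanishes empty t d<t r α = ≡.refl
ChainSum-vanishes (_∪_ {f} {g} U V) t d<t r α = ≡.trans (coeff-++ (f r) (g r) (α , t))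
  (cong₂ ℤ._+_ (ChainSum-vanishes U t d<t r α) (ChainSum-vanishes V t d<t r α))
ChainSum-vanishes (resp f≅g U) t d<t r α = ≡.trans (≡.sym (coeffs (at f≅g r) (α , t))) (ChainSum-vanishes U t d<t r α)

-- Left of the common centre a step from `t` to `t + 1` can enter a chain but cannot leave one. The
-- representing list collects the partitions of the chains entered.
ChainSum-increasing : ∀ {d f} → ChainSum d f → ∀ t → suc (2 * t) < d →
  ∃ λ Λ → Represents Λ (λ r α → coeffAt (suc t) f r α ℤ.- coeffAt t f r α)
ChainSum-increasing (chain s l λs ≡.refl) t 1+2t<d with position s l (suc t) | position s l t
... | below 1+t<s | _ = [] , λ r α → cong₂ ℤ._-_
  (chainCoeff-outside s λs r α (suc t) l (inj₁ 1+t<s)) (chainCoeff-outside s λs r α t l (inj₁ (ℕ.<-trans (ℕ.n<1+n t) 1+t<s)))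
... | inside s≤1+t 1+t≤s+l | below t<s = (λs ∷ []) , λ r α → ≡.trans
  (cong₂ ℤ._-_ (chainCoeff-inside s λs r α (suc t) l s≤1+t 1+t≤s+l) (chainCoeff-outside s λs r α t l (inj₁ t<s)))
  (≡.trans (ℤ.+-identityʳ (coeff (eλ λs r) (α , 0))) (cong (λ p → coeff p (α , 0)) (≡.sym (L.++-identityʳ (eλ λs r)))))
... | inside s≤1+t 1+t≤s+l | inside s≤t t≤s+l = [] , λ r α → ≡.trans
  (cong₂ ℤ._-_ (chainCoeff-inside s λs r α (suc t) l s≤1+t 1+t≤s+l) (chainCoeff-inside s λs r α t l s≤t t≤s+l))
  (ℤ.+-inverseʳ (coeff (eλ λs r) (α , 0)))
... | inside s≤1+t 1+t≤s+l | above s+l<t = contradiction (ℕ.<-trans s+l<t 1+t≤s+l) (ℕ.<-irrefl ≡.refl)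
-- A chain that has ended has s + l at most t, hence d = 2s + l is at most 2t, past the range
-- considered.
... | above (s≤s s+l≤t) | _ = contradiction (ℕ.≤-<-trans d≤2t (ℕ.<-trans (ℕ.n<1+n (2 * t)) 1+2t<d)) (ℕ.<-irrefl ≡.refl)
  where
  double : ∀ s l → s + l + (s + l) ≡ s + s + l + l
  double = ℕ-Solver.solve-∀
  d≤2t : s + s + l ≤ 2 * t
  d≤2t = ℕ.≤-trans (ℕ.m≤m+n (s + s + l) l) (ℕ.≤-trans (ℕ.≤-reflexive (≡.sym (double s l)))
    (ℕ.≤-trans (ℕ.+-mono-≤ s+l≤t s+l≤t) (ℕ.≤-reflexive (cong (λ m → t + m) (≡.sym (ℕ.+-identityʳ t))))))
ChainSum-increasing empty t _ = [] , λ r α → ≡.refl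
ChainSum-increasing (_∪_ {f} {g} U V) t 1+2t<d with ChainSum-increasing U t 1+2t<d | ChainSum-increasing V t 1+2t<d
... | Λ , eq | Λ' , eq' = Λ ++ Λ' , λ r α → ≡.trans
  (cong₂ ℤ._-_ (coeff-++ (f r) (g r) (α , suc t)) (coeff-++ (f r) (g r) (α , t))) (≡.trans
  (regroup (coeffAt (suc t) f r α) (coeffAt (suc t) g r α) (coeffAt t f r α) (coeffAt t g r α)) (≡.trans
  (cong₂ ℤ._+_ (eq r α) (eq' r α))
  (≡.sym (≡.trans (coeffs (at (eΛ-++ Λ Λ') r) (α , 0)) (coeff-++ (eΛ Λ r) (eΛ Λ' r) (α , 0))))))
  where
  regroup : ∀ a b c d → (a ℤ.+ b) ℤ.- (c ℤ.+ d) ≡ (a ℤ.- c) ℤ.+ (b ℤ.- d)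
  regroup = ℤ-Solver.solve-∀
ChainSum-increasing (resp f≅g U) t 1+2t<d with ChainSum-increasing U t 1+2t<d
... | Λ , eq = Λ , λ r α → ≡.trans (cong₂ ℤ._-_ (≡.sym (coeffs (at f≅g r) (α , suc t))) (≡.sym (coeffs (at f≅g r) (α , t)))) (eq r α)

ChainSum⇒EPositive : ∀ {d f} → ChainSum d f → EPositive f
ChainSum⇒EPositive {f = f} U t with ChainSum-positive U t
... | Λ , eq = Λ , λ { r (α , s) → ≡.trans (coeff-coeffQ t f r α s) (≡.trans
  (cong (if s ≡ᵇ 0 then_else + 0) (eq r α)) (≡.sym (coeff-QFree (eΛ-QFree Λ r) α s))) }

ChainSum⇒EUnimodal : ∀ {d f} → ChainSum d f → EUnimodalCentreHalf f d
ChainSum⇒EUnimodal {d} {f} U =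
    (λ t t≤d → coeffQ-≈ {f} {f} (ChainSum-symmetric U t t≤d))
  , (λ { t d<t r (α , s) → ≡.trans (coeff-coeffQ t f r α s)
         (≡.trans (cong (if s ≡ᵇ 0 then_else + 0) (ChainSum-vanishes U t d<t r α)) (if-same (s ≡ᵇ 0))) })
  , increasing
  where
  if-same : ∀ b → (if b then + 0 else + 0) ≡ + 0
  if-same true = ≡.refl
  if-same false = ≡.refl
  if-- : ∀ b x y → (if b then x else + 0) ℤ.+ ℤ.- (if b then y else + 0) ≡ (if b then x ℤ.- y else + 0)
  if-- true x y = ≡.refl
  if-- false x y = ≡.refl
  increasing : ∀ t → suc (2 * t) < d → IsEPositiveSym (coeffQ (suc t) f ⊖ coeffQ t f)
  increasing t 1+2t<d with ChainSum-increasing U t 1+2t<d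
  ... | Λ , eq = Λ , λ { r (α , s) → ≡.trans (coeff-++ (coeffQ (suc t) f r) (neg (coeffQ t f) r) (α , s)) (≡.trans
    (cong₂ ℤ._+_ (coeff-coeffQ (suc t) f r α s) (≡.trans (coeff-neg (coeffQ t f) r (α , s)) (cong ℤ.-_ (coeff-coeffQ t f r α s)))) (≡.trans
    (if-- (s ≡ᵇ 0) (coeffAt (suc t) f r α) (coeffAt t f r α)) (≡.trans
    (cong (if s ≡ᵇ 0 then_else + 0) (eq r α)) (≡.sym (coeff-QFree (eΛ-QFree Λ r) α s))))) }

-- The number of edges

open ListSum ℕ.+-0-commutativeMonoid using (listSum; listSum-pairs-cong; listSum-pairs-suc)
open MonoidSum ℕ.+-0-commutativeMonoid using (sum; sum-cong-≗; sum-replicate-zero)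

edges : (ℕ → ℕ → Bool) → ℕ → ℕ
edges E n = listSum (λ (u , v) → b2n (E u v)) (pairs n)

length-filterᵇ : ∀ {A : Set} (p : A → Bool) xs → length (filterᵇ p xs) ≡ listSum (b2n ∘ p) xs
length-filterᵇ p [] = ≡.refl
length-filterᵇ p (x ∷ xs) with p x
... | true = cong suc (length-filterᵇ p xs)
... | false = length-filterᵇ p xs

edgeCount-edges : ∀ G → edgeCount G ≡ edges (edge G) (N G)
edgeCount-edges G = ≡.trans (length-filterᵇ _ (pairs (N G))) (listSum-pairs-cong (N G) (λ _ _ → ≡.refl))

edges-suc : ∀ E n → edges E (suc n) ≡ sum {n} (λ j → b2n (E 1 (2 + toℕ j))) + edges (shift E) n
edges-suc E n = listSum-pairs-suc (λ (u , v) → b2n (E u v)) n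

edges-cong : ∀ E E' n → (∀ u v → u < v → v < n → E (suc u) (suc v) ≡ E' (suc u) (suc v)) → edges E n ≡ edges E' n
edges-cong E E' zero E≡E' = ≡.refl
edges-cong E E' (suc n) E≡E' = ≡.trans (edges-suc E n) (≡.trans
  (cong₂ _+_ (sum-cong-≗ {n} (λ j → cong b2n (E≡E' 0 (suc (toℕ j)) (s≤s z≤n) (s≤s (toℕ<n j)))))
    (edges-cong (shift E) (shift E') n (λ u v u<v v<n → E≡E' (suc u) (suc v) (s≤s u<v) (s≤s v<n))))
  (≡.sym (edges-suc E' n)))

sum-<ᵇ : ∀ {n p} → p ≤ n → sum {n} (λ j → b2n (toℕ j <ᵇ p)) ≡ p
sum-<ᵇ {n} z≤n = sum-replicate-zero n
sum-<ᵇ (s≤s p≤n) = cong suc (sum-<ᵇ p≤n)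

edges-complete : ∀ n → edges complete n ≡ triangle n
edges-complete zero = ≡.refl
edges-complete (suc n) = ≡.trans (edges-suc complete n) (≡.trans
  (cong₂ _+_ (≡.trans (sum-cong-≗ {n} (λ j → cong b2n (≡.sym (<ᵇ-true (toℕ<n j))))) (sum-<ᵇ ℕ.≤-refl)) (edges-complete n))
  (ℕ.+-comm n (triangle n)))

-- Vertices are removed in the order in which `Z-melt` colours them: one edge for each of the n
-- stick vertices, then `N ∸ k`, then a complete graph. The count thereby has literally the form of
-- the index in `melt-ChainSum`.
edges-melt : ∀ N k n → k ≤ N → edges (meltEdge (suc N) n k) (n + suc N) ≡ n + ((N ∸ k) + triangle N)
edges-melt N k zero k≤N = ≡.trans (edges-suc E N) (cong₂ _+_
  (≡.trans (sum-cong-≗ {N} (λ j → cong b2n (meltEdge-first (toℕ j) k≤N (toℕ<n j)))) (sum-<ᵇ (ℕ.m∸n≤m N k)))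
  (≡.trans (edges-cong (shift E) complete N (meltEdge-rest N k)) (edges-complete N)))
  where E = meltEdge (suc N) 0 k
edges-melt N k (suc n) k≤N = ≡.trans (edges-suc E (n + suc N)) (cong₂ _+_
  (≡.trans (sum-cong-≗ {n + suc N} (λ j → cong b2n (≡.trans (meltEdge-stick (suc N) n k (toℕ j)) (≡ᵇ-0 (toℕ j)))))
    (sum-<ᵇ (ℕ.≤-trans (s≤s z≤n) (ℕ.m≤n+m (suc N) n))))
  (≡.trans (edges-cong (shift E) (meltEdge (suc N) n k) (n + suc N) (λ u v _ _ → meltEdge-shift n (ℕ.m≤n⇒m≤1+n k≤N) u v))
    (edges-melt N k n k≤N)))
  where
  E = meltEdge (suc N) (suc n) k
  ≡ᵇ-0 : ∀ j → (j ≡ᵇ 0) ≡ (j <ᵇ 1)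
  ≡ᵇ-0 zero = ≡.refl
  ≡ᵇ-0 (suc j) = ≡.refl

edgeCount-melt : ∀ N n k → k ≤ suc N → edgeCount (MeltingLollipop (2 + N) n k) ≡ n + ((suc N ∸ k) + triangle (suc N))
edgeCount-melt N n k k≤1+N = ≡.trans (edgeCount-edges (MeltingLollipop (2 + N) n k)) (≡.trans
  (cong (edges (meltEdge (2 + N) n k)) (ℕ.+-comm (2 + N) n)) (edges-melt (suc N) k n k≤1+N))

theorem4p9 : (m n k : ℕ) → 2 ≤ m → k ≤ m ∸ 1 →
    (X (MeltingLollipop m n k) ≈
    qint (m ∸ k ∸ 1) ⊗ qfact (m ∸ 2)
    ⊗ (qint (m + n) ⊗ e (m + n)
    ⊕ Σ< n (λ i → q ⊗ qint (m + i ∸ 1) ⊗ X (P (n ∸ i)) ⊗ e (m + i)))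
    ⊕ qpow (m ∸ k ∸ 1) ⊗ qint k ⊗ qfact (m ∸ 2) ⊗ X (P (n + 1)) ⊗ e (m ∸ 1))
    × EPositive (X (MeltingLollipop m n k))
    × EUnimodalCentreHalf (X (MeltingLollipop m n k)) (edgeCount (MeltingLollipop m n k))
theorem4p9 (suc (suc N)) n k (s≤s (s≤s z≤n)) k≤1+N =
    subst₂ (λ p n+1 → X (MeltingLollipop (2 + N) n k) ≈
        qint p ⊗ qfact N
          ⊗ (qint (2 + N + n) ⊗ e (2 + N + n)
             ⊕ Σ< n (λ i → q ⊗ qint (suc N + i) ⊗ X (P (n ∸ i)) ⊗ e (2 + N + i)))
        ⊕ qpow p ⊗ qint k ⊗ qfact N ⊗ X (P n+1) ⊗ e (suc N))
      -- This passes from `suc N ∸ k` to m ∸ k ∸ 1, which relies on k being at most m - 1, and from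
      -- `suc n` to n + 1.
      (cong (_∸ 1) (≡.sym (suc-∸ k≤1+N))) (ℕ.+-comm 1 n) (≅⇒≈ (X-melt N n k k≤1+N))
  , ChainSum⇒EPositive (melt-ChainSum N n k k≤1+N)
  , subst (EUnimodalCentreHalf (X (MeltingLollipop (2 + N) n k))) (≡.sym (edgeCount-melt N n k k≤1+N))
      (ChainSum⇒EUnimodal (melt-ChainSum N n k k≤1+N))
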